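{- Let $t\ge 0$ be an integer and let $\epsilon\in\mathbb{R}$ satisfy $0<\epsilon\ll 1$. There exists a digraph $G$ with nonnegative edge costs on $\nu=\nu(t,\epsilon)=\Theta(t/\epsilon)$ vertices such that, for the metric completion $H$ of $G$, the integrality ratio of the level-$t$ Sherali–Adams tightening of the standard (DFJ) LP relaxation of ATSP on $H$ is at least $1+\frac{1-\epsilon}{2t+3}$.
   Context: Metric completion: for a digraph $G=(V,E)$ with nonnegative edge costs $c$, its metric completion is the complete digraph $H$ on $V$ in which the cost $c'(v,w)$ of edge $(v,w)$ is the minimum $c$-cost of a $v$–$w$ dipath in $G$. Standard (DFJ) LP of ATSP on a complete digraph $H=(V,E_H)$: variables $x_e$, $e\in E_H$; minimize $\sum_e c'_e x_e$ subject to $x(\delta^{in}(S))\ge 1$ and $x(\delta^{out}(S))\ge 1$ for all $\emptyset\subsetneq S\subsetneq V$, $x(\delta^{in}(\{v\}))=1$ and $x(\delta^{out}(\{v\}))=1$ for all $v\in V$, and $0\le x\le 1$. Here $\delta^{out}(U)$ ($\delta^{in}(U)$) is the set of edges leaving (entering) $U$ and $x(F)=\sum_{e\in F}x_e$. Let $\hat P$ denote its feasible polytope. Sherali–Adams: let $\hat P\subseteq[0,1]^n$ be a polytope given by a finite system of linear inequalities $\sum_{i=1}^n a_i y_i\ge b$ (the system includes $0\le y_i\le 1$ for all $i$; equations are written as two inequalities). For an integer $t\ge0$, the level-$t$ Sherali–Adams tightening $SA^t(\hat P)$ is the set of vectors $y=(y_S)$ indexed by subsets $S\subseteq\{1,\dots,n\}$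 with $|S|\le t+1$, with $y_\emptyset=1$, such that for every inequality $\sum_i a_i y_i\ge b$ of the system and every pair of disjoint sets $S,Q\subseteq\{1,\dots,n\}$ with $|S|+|Q|\le t$: $\sum_{i=1}^n a_i\sum_{T\subseteq Q}(-1)^{|T|}y_{S\cup T\cup\{i\}}\ \ge\ b\sum_{T\subseteq Q}(-1)^{|T|}y_{S\cup T}$. Integrality ratio of the instance: the minimum cost of a Hamiltonian dicycle in $H$ (w.r.t. $c'$) divided by $\min\{\sum_{e}c'_e\,y_{\{e\}} : y\in SA^t(\hat P)\}$. -}

module Defs where

open import Data.Bool using (Bool; true; false; if_then_else_; _∧_; not)
open import Data.Nat as ℕ using (ℕ; zero; suc)
open import Data.Fin as Fin using (Fin; remQuot)
open import Data.Fin.Subset as Sub using (Subset; ⁅_⁆; _∪_; _∩_; ∣_∣; _⊆_)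
open import Data.Fin.Subset.Properties using (_⊆?_)
open import Data.Vec as Vec using (Vec; []; _∷_; lookup)
open import Data.List as List using (List; []; _∷_; _++_; map; filter; allFin; head; last)
open import Data.List.Relation.Unary.Unique.Propositional using (Unique)
open import Data.List.Membership.Propositional using (_∈_)
open import Data.Maybe using (Maybe; just)
open import Data.Product using (Σ; _×_; _,_; proj₁; proj₂; ∃)
open import Data.Unit using (⊤)
open import Relation.Binary.PropositionalEquality using (_≡_; _≢_)
open import Relation.Nullary using (yes; no)
open import Data.Rational as ℚ using (ℚ; 0ℚ; 1ℚ; _+_; _*_; -_; _≤_; _<_)

sumℚ : List ℚ → ℚ
sumℚ = List.foldr _+_ 0ℚ

sgn : ℕ → ℚ
sgn zero    = 1ℚ
sgn (suc k) = - sgn k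

allSubsets : (n : ℕ) → List (Subset n)
allSubsets zero    = Vec.[] ∷ []
allSubsets (suc n) = map (false Vec.∷_) (allSubsets n) ++ map (true Vec.∷_) (allSubsets n)

subsetsOf : {n : ℕ} → Subset n → List (Subset n)
subsetsOf {n} Q = filter (λ T → T ⊆? Q) (allSubsets n)

-- Digraphs on vertex set Fin ν.  Edge relation E (a boolean matrix) and
-- costs c (only relevant on edges).

Consec : {ν : ℕ} → (Fin ν → Fin ν → Set) → List (Fin ν) → Set
Consec R []            = ⊤
Consec R (x ∷ [])      = ⊤
Consec R (x ∷ y ∷ xs)  = R x y × Consec R (y ∷ xs)

pathCost : {ν : ℕ} → (Fin ν → Fin ν → ℚ) → List (Fin ν) → ℚ
pathCost c []           = 0ℚ
pathCost c (x ∷ [])     = 0ℚ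
pathCost c (x ∷ y ∷ xs) = c x y + pathCost c (y ∷ xs)

IsDipath : {ν : ℕ} → (Fin ν → Fin ν → Bool) → Fin ν → Fin ν → List (Fin ν) → Set
IsDipath E v w p =
  Unique p × head p ≡ just v × last p ≡ just w × Consec (λ a b → E a b ≡ true) p

IsMetricCompletion : {ν : ℕ} → (Fin ν → Fin ν → Bool) → (Fin ν → Fin ν → ℚ)
                   → (Fin ν → Fin ν → ℚ) → Set
IsMetricCompletion {ν} E c d =
  (v w : Fin ν) → v ≢ w →
    (Σ (List (Fin ν)) λ p → IsDipath E v w p × pathCost c p ≡ d v w)
    × ((p : List (Fin ν)) → IsDipath E v w p → d v w ≤ pathCost c p)

IsHamiltonianDicycle : {ν : ℕ} → List (Fin ν) → Set
IsHamiltonianDicycle {ν} order = Unique order × ((v : Fin ν) → v ∈ order)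

cycleCost : {ν : ℕ} → (Fin ν → Fin ν → ℚ) → List (Fin ν) → ℚ
cycleCost d []       = 0ℚ
cycleCost d (x ∷ xs) = pathCost d ((x ∷ xs) ++ (x ∷ []))

-- Variables of the LP: the edges of the complete digraph H on Fin ν.
-- We index them by Fin (ν * ν), index i encoding the pair remQuot ν i = (v , w);
-- indices with v ≡ w (loops) are not edges of H and carry no variable.

tailV : (ν : ℕ) → Fin (ν ℕ.* ν) → Fin ν
tailV ν i = proj₁ (remQuot {ν} ν i)

headV : (ν : ℕ) → Fin (ν ℕ.* ν) → Fin ν
headV ν i = proj₂ (remQuot {ν} ν i)

IsEdge : (ν : ℕ) → Fin (ν ℕ.* ν) → Set
IsEdge ν i = tailV ν i ≢ headV ν i

IsEdgeSet : (ν : ℕ) → Subset (ν ℕ.* ν) → Set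
IsEdgeSet ν S = (i : Fin (ν ℕ.* ν)) → lookup S i ≡ true → IsEdge ν i

δout : (ν : ℕ) → Subset ν → Fin (ν ℕ.* ν) → ℚ
δout ν U i = if lookup U (tailV ν i) ∧ not (lookup U (headV ν i)) then 1ℚ else 0ℚ

δin : (ν : ℕ) → Subset ν → Fin (ν ℕ.* ν) → ℚ
δin ν U i = if not (lookup U (tailV ν i)) ∧ lookup U (headV ν i) then 1ℚ else 0ℚ

unitV : {n : ℕ} → Fin n → Fin n → ℚ
unitV i j with i Fin.≟ j
... | yes _ = 1ℚ
... | no  _ = 0ℚ

negV : {n : ℕ} → (Fin n → ℚ) → Fin n → ℚ
negV a j = - a j

-- The inequality system (a · x ≥ b) of the standard DFJ LP of ATSP on H;
-- equations are written as two inequalities.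
data DFJ (ν : ℕ) : (Fin (ν ℕ.* ν) → ℚ) → ℚ → Set where
  cutIn   : (U : Subset ν) → 0 ℕ.< ∣ U ∣ → ∣ U ∣ ℕ.< ν → DFJ ν (δin ν U) 1ℚ
  cutOut  : (U : Subset ν) → 0 ℕ.< ∣ U ∣ → ∣ U ∣ ℕ.< ν → DFJ ν (δout ν U) 1ℚ
  degIn≥  : (v : Fin ν) → DFJ ν (δin ν ⁅ v ⁆) 1ℚ
  degIn≤  : (v : Fin ν) → DFJ ν (negV (δin ν ⁅ v ⁆)) (- 1ℚ)
  degOut≥ : (v : Fin ν) → DFJ ν (δout ν ⁅ v ⁆) 1ℚ
  degOut≤ : (v : Fin ν) → DFJ ν (negV (δout ν ⁅ v ⁆)) (- 1ℚ)
  lower   : (i : Fin (ν ℕ.* ν)) → IsEdge ν i → DFJ ν (unitV i) 0ℚ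
  upper   : (i : Fin (ν ℕ.* ν)) → IsEdge ν i → DFJ ν (negV (unitV i)) (- 1ℚ)

-- Sherali–Adams level t.  y is indexed by sets of variables; only sets of
-- size ≤ t+1 consisting of edges are ever used.

altSum : {n : ℕ} → (Subset n → ℚ) → Subset n → Subset n → ℚ
altSum y S Q = sumℚ (map (λ T → sgn ∣ T ∣ * y (S ∪ T)) (subsetsOf Q))

saLHS : {n : ℕ} → (Fin n → ℚ) → (Subset n → ℚ) → Subset n → Subset n → ℚ
saLHS {n} a y S Q =
  sumℚ (map (λ i → a i * sumℚ (map (λ T → sgn ∣ T ∣ * y (S ∪ T ∪ ⁅ i ⁆)) (subsetsOf Q)))
            (allFin n))

InSA : (t ν : ℕ) → (Subset (ν ℕ.* ν) → ℚ) → Set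
InSA t ν y =
  y Sub.⊥ ≡ 1ℚ ×
  ((a : Fin (ν ℕ.* ν) → ℚ) (b : ℚ) → DFJ ν a b →
   (S Q : Subset (ν ℕ.* ν)) → IsEdgeSet ν S → IsEdgeSet ν Q →
   S ∩ Q ≡ Sub.⊥ → ∣ S ∣ ℕ.+ ∣ Q ∣ ℕ.≤ t →
   b * altSum y S Q ≤ saLHS a y S Q)

edgeCost : (ν : ℕ) → (Fin ν → Fin ν → ℚ) → Fin (ν ℕ.* ν) → ℚ
edgeCost ν d i with tailV ν i Fin.≟ headV ν i
... | yes _ = 0ℚ
... | no  _ = d (tailV ν i) (headV ν i)

lpCost : {ν : ℕ} → (Fin ν → Fin ν → ℚ) → (Subset (ν ℕ.* ν) → ℚ) → ℚ
lpCost {ν} d y = sumℚ (map (λ i → edgeCost ν d i * y ⁅ i ⁆) (allFin (ν ℕ.* ν)))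

{-# OPTIONS --safe #-}
-- The digraph G is a ladder on a₀ … aₙ, b₀ … bₙ with rungs aᵢ → bᵢ (i < n) and bᵢ → aᵢ (i > 0) of cost 0,
-- arcs aᵢ → aᵢ₊₁ and bᵢ₊₁ → bᵢ of cost 1, and long arcs aₙ → a₀ and b₀ → bₙ of cost n; with pos aᵢ = pos bᵢ = i,
-- every arc u → v costs |pos u - pos v|.
-- The a-cycle and the b-cycle form a cycle cover C of cost 4n.  Breaking the ladder at the gap g, that is
-- replacing a_g → a_{g+1} and b_{g+1} → b_g by a_g → b_g and b_{g+1} → a_{g+1}, turns C into a Hamiltonian
-- cycle H_g that is cheaper by 2, and the n exchanges are pairwise disjoint.
--
-- With M = t + 2 ≤ n, extrapolate: y_S = (1 - n/M) [S ⊆ C] + (1/M) Σ_g [S ⊆ H_g].  Although the weight of C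
-- may be negative, conditioning on |S| + |Q| ≤ t edges discards at most t of the H_g, and by disjointness the
-- H_g together can lower the slack s of C in a constraint by at most 2s when s > 0; so y is feasible for SA^t.
-- Its cost is 4n - 2n/M = 2n (2t+3)/(t+2).
--
-- Conversely a spanning closed walk crosses each cut {pos ≤ g} equally often in both directions, say o_g ≥ 1
-- times, and costs at least Σ_g 2 o_g.  For g < h, entering the block {g < pos ≤ h}, entering a₀ (only from
-- aₙ) and entering bₙ (only from b₀) are charged to o_g + o_h ≥ 3, so at most one o_g is 1 and the cost is at
-- least 4n - 2.  Choosing n ≈ (t+2)/ε gives the ratio.

module Submission where

open import Defs
open import Algebra.Bundles using (CommutativeRing)
open import Data.Bool using (Bool; true; false; _∧_; _∨_; not; if_then_else_)
import Data.Bool.Properties as BoolP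
open import Data.Fin as Fin using (Fin; zero; suc; toℕ; fromℕ; fromℕ<; inject₁; splitAt; join; combine; _↑ˡ_; _↑ʳ_)
open import Data.Fin.Induction using (<-weakInduction)
import Data.Fin.Properties as FinP
open import Data.Fin.Relation.Unary.Top using (view; view-fromℕ; view-inject₁; ‵fromℕ; ‵inject₁)
open import Data.Fin.Subset as Sub using (Subset; ⁅_⁆; _∪_; ∣_∣; outside; inside)
open import Data.Fin.Subset.Properties using (_⊆?_)
open import Data.Integer as ℤ using (+_)
import Data.Integer.Properties as ℤP
open import Data.List as List
  using (List; []; _∷_; _++_; allFin; tabulate; filter; head; last; length; cartesianProductWith)
open import Data.List.Extrema.Nat using (argmin; argmin-all; f[argmin]≤v⁺)
open import Data.List.Membership.DecPropositional using (_∈?_)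
open import Data.List.Membership.Propositional using (_∈_; lose)
open import Data.List.Membership.Propositional.Properties
  using (∈-lookup; ∈-filter⁺; ∈-cartesianProductWith⁺; ∈-allFin)
import Data.List.Properties as ListP
open import Data.List.Relation.Unary.All as All using (All)
import Data.List.Relation.Unary.All.Properties as AllP
open import Data.List.Relation.Unary.AllPairs as AllPairs using ([]; _∷_)
open import Data.List.Relation.Unary.Any using (here; there)
open import Data.List.Relation.Unary.Unique.Propositional using (Unique)
open import Data.Maybe using (just)
import Data.Maybe.Properties as MaybeP
open import Data.Nat as ℕ using (ℕ; zero; suc; z≤n; s≤s; _<ᵇ_)
import Data.Nat.Properties as ℕP
import Data.Nat.Tactic.RingSolver as ℕRing
open import Data.Product using (Σ; _×_; ∃; _,_; proj₁; proj₂)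
open import Data.Rational as ℚ using (ℚ; 0ℚ; 1ℚ; _+_; _-_; _*_; -_; _/_; _≤_; _<_)
import Data.Rational.Properties as ℚP
open import Data.Rational.Solver using (module +-*-Solver)
import Data.Rational.Unnormalised as ℚᵘ
import Data.Rational.Unnormalised.Properties as ℚᵘP
open import Data.Sum using (_⊎_; inj₁; inj₂; [_,_]′)
open import Data.Sum.Properties using (inj₁-injective; inj₂-injective)
open import Data.Unit using (tt)
open import Data.Vec using ([]; _∷_; lookup)
open import Data.Vec.Properties using (lookup-replicate)
open import Function using (_∘_)
open import Relation.Binary.Construct.Closure.ReflexiveTransitive using (Star; _◅_; _◅◅_; gmap)
open import Relation.Binary.PropositionalEquality
open import Relation.Nullary using (Dec; yes; no; does; ¬?; contradiction; _×-dec_)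
open import Relation.Nullary.Decidable using (dec-true; dec-false)

open import Algebra.Properties.Semiring.Sum (CommutativeRing.semiring ℚP.+-*-commutativeRing)
  using (sum; sum-cong-≗; sum-replicate-zero; sum-init-last; ∑-distrib-+; ∑-comm; *-distribˡ-sum; *-distribʳ-sum)
open import Algebra.Properties.Semiring.Sum ℕP.+-*-semiring
  using () renaming (sum to sumℕ; sum-cong-≗ to sumℕ-cong; ∑-distrib-+ to ∑ℕ-distrib-+)

-- Finite sums and rational arithmetic

𝟙 : Bool → ℚ
𝟙 true  = 1ℚ
𝟙 false = 0ℚ

-- Defined by recursion so that `ι (suc k)` unfolds to `1ℚ + ι k`, the shape that the ring solver
-- goals use. `ι≡/1` connects it with the fractions `+ k / 1` of the theorem.
ι : ℕ → ℚ
ι zero    = 0ℚ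
ι (suc k) = 1ℚ + ι k

+-congˡ : ∀ r {p q} → p ≡ q → r + p ≡ r + q
+-congˡ r refl = refl

*-congˡ : ∀ r {p q} → p ≡ q → r * p ≡ r * q
*-congˡ r refl = refl

0≤1 : 0ℚ ≤ 1ℚ
0≤1 = ℚP.nonNegative⁻¹ 1ℚ

𝟙-nonneg : ∀ b → 0ℚ ≤ 𝟙 b
𝟙-nonneg true  = 0≤1
𝟙-nonneg false = ℚP.≤-refl

𝟙-∧ : ∀ a b → 𝟙 (a ∧ b) ≡ 𝟙 a * 𝟙 b
𝟙-∧ true  b = sym (ℚP.*-identityˡ (𝟙 b))
𝟙-∧ false b = sym (ℚP.*-zeroˡ (𝟙 b))

𝟙-not : ∀ a → 𝟙 (not a) ≡ 1ℚ - 𝟙 a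
𝟙-not true  = refl
𝟙-not false = refl

*-nonneg : ∀ {p q} → 0ℚ ≤ p → 0ℚ ≤ q → 0ℚ ≤ p * q
*-nonneg {p} {q} 0≤p 0≤q =
  subst (_≤ p * q) (ℚP.*-zeroʳ p) (ℚP.*-monoˡ-≤-nonNeg p ⦃ ℚ.nonNegative 0≤p ⦄ 0≤q)

*-monoˡ : ∀ {r p q} → 0ℚ ≤ r → p ≤ q → r * p ≤ r * q
*-monoˡ {r} 0≤r = ℚP.*-monoˡ-≤-nonNeg r ⦃ ℚ.nonNegative 0≤r ⦄

p≤q⇒0≤q-p : ∀ {p q} → p ≤ q → 0ℚ ≤ q - p
p≤q⇒0≤q-p {p} {q} p≤q = subst (_≤ q - p) (ℚP.+-inverseʳ p) (ℚP.+-monoˡ-≤ (- p) p≤q)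

0≤q-p⇒p≤q : ∀ {p q} → 0ℚ ≤ q - p → p ≤ q
0≤q-p⇒p≤q {p} {q} h = subst₂ _≤_ (ℚP.+-identityˡ p)
  (solve 2 (λ q p → (q :- p) :+ p := q) refl q p) (ℚP.+-monoˡ-≤ p h)
  where
  open +-*-Solver

sum-mono : ∀ {n} {f g : Fin n → ℚ} → (∀ i → f i ≤ g i) → sum f ≤ sum g
sum-mono {zero}  h = ℚP.≤-refl
sum-mono {suc n} h = ℚP.+-mono-≤ (h zero) (sum-mono (h ∘ suc))

sum-nonneg : ∀ {n} {f : Fin n → ℚ} → (∀ i → 0ℚ ≤ f i) → 0ℚ ≤ sum f
sum-nonneg {n} {f} h = subst (_≤ sum f) (sum-replicate-zero n) (sum-mono h)

sum-neg : ∀ {n} (f : Fin n → ℚ) → sum (λ i → - f i) ≡ - sum f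
sum-neg {zero}  f = refl
sum-neg {suc n} f = trans (+-congˡ (- f zero) (sum-neg (f ∘ suc))) (sym (ℚP.neg-distrib-+ (f zero) _))

sum-minus : ∀ {n} (f g : Fin n → ℚ) → sum (λ i → f i - g i) ≡ sum f - sum g
sum-minus f g = trans (∑-distrib-+ f (λ i → - g i)) (+-congˡ (sum f) (sum-neg g))

sum-one : ∀ n → sum {n} (λ _ → 1ℚ) ≡ ι n
sum-one zero    = refl
sum-one (suc n) = +-congˡ 1ℚ (sum-one n)

sum-allFin : ∀ {n} (f : Fin n → ℚ) → sumℚ (List.map f (allFin n)) ≡ sum f
sum-allFin {n} f = trans (cong sumℚ (ListP.map-tabulate {n = n} (λ i → i) f)) (go f)
  where
  go : ∀ {n} (f : Fin n → ℚ) → sumℚ (tabulate f) ≡ sum f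
  go {zero}  f = refl
  go {suc n} f = +-congˡ (f zero) (go (f ∘ suc))

sum-δ : ∀ {n} (x : Fin n) (f : Fin n → ℚ) → sum (λ u → f u * 𝟙 (does (u Fin.≟ x))) ≡ f x
sum-δ {suc n} zero f = begin
  f zero * 1ℚ + sum (λ u → f (suc u) * 0ℚ)
    ≡⟨ cong₂ _+_ (ℚP.*-identityʳ (f zero)) (sum-cong-≗ {n} (λ u → ℚP.*-zeroʳ (f (suc u)))) ⟩
  f zero + sum {n} (λ _ → 0ℚ)  ≡⟨ +-congˡ (f zero) (sum-replicate-zero n) ⟩
  f zero + 0ℚ                  ≡⟨ ℚP.+-identityʳ _ ⟩
  f zero                       ∎
  where
  open ≡-Reasoning
sum-δ {suc n} (suc x) f = trans
  (cong₂ _+_ (ℚP.*-zeroʳ (f zero)) (sum-δ x (f ∘ suc))) (ℚP.+-identityˡ _)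

sum-↑ : ∀ m {n} (f : Fin (m ℕ.+ n) → ℚ) →
        sum f ≡ sum (λ i → f (i ↑ˡ n)) + sum (λ j → f (m ↑ʳ j))
sum-↑ zero    f = sym (ℚP.+-identityˡ _)
sum-↑ (suc m) f = trans (+-congˡ (f zero) (sum-↑ m (f ∘ suc))) (sym (ℚP.+-assoc (f zero) _ _))

sum-combine : ∀ m {n} (f : Fin (m ℕ.* n) → ℚ) →
              sum f ≡ sum {m} (λ i → sum {n} (λ j → f (combine i j)))
sum-combine zero    f = refl
sum-combine (suc m) {n} f = trans (sum-↑ n f) (+-congˡ (sum (λ j → f (j ↑ˡ (m ℕ.* n)))) (sum-combine m (f ∘ (n ↑ʳ_))))

ι-+ : ∀ a b → ι (a ℕ.+ b) ≡ ι a + ι b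
ι-+ zero    b = sym (ℚP.+-identityˡ (ι b))
ι-+ (suc a) b = trans (+-congˡ 1ℚ (ι-+ a b)) (sym (ℚP.+-assoc 1ℚ (ι a) (ι b)))

ι-* : ∀ a b → ι (a ℕ.* b) ≡ ι a * ι b
ι-* zero    b = sym (ℚP.*-zeroˡ (ι b))
ι-* (suc a) b = begin
  ι (b ℕ.+ a ℕ.* b)     ≡⟨ ι-+ b (a ℕ.* b) ⟩
  ι b + ι (a ℕ.* b)     ≡⟨ +-congˡ (ι b) (ι-* a b) ⟩
  ι b + ι a * ι b       ≡⟨ solve 2 (λ x y → y :+ x :* y := (con 1ℚ :+ x) :* y) refl (ι a) (ι b) ⟩
  (1ℚ + ι a) * ι b      ∎
  where
  open ≡-Reasoning
  open +-*-Solver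

ι-nonneg : ∀ k → 0ℚ ≤ ι k
ι-nonneg zero    = ℚP.≤-refl
ι-nonneg (suc k) = ℚP.+-mono-≤ 0≤1 (ι-nonneg k)

ι-mono : ∀ {a b} → a ℕ.≤ b → ι a ≤ ι b
ι-mono {b = b} z≤n = ι-nonneg b
ι-mono (s≤s h)     = ℚP.+-monoʳ-≤ 1ℚ (ι-mono h)

0<ι : ∀ {k} → 0 ℕ.< k → 0ℚ < ι k
0<ι 0<k = ℚP.<-≤-trans (ℚP.positive⁻¹ 1ℚ) (ι-mono 0<k)

ι≡/1 : ∀ k → ι k ≡ + k / 1
ι≡/1 zero    = refl
ι≡/1 (suc k) = trans (+-congˡ 1ℚ (ι≡/1 k)) (ℚP.toℚᵘ-injective (begin
  ℚ.toℚᵘ (1ℚ + (+ k / 1))                      ≈⟨ ℚP.toℚᵘ-homo-+ 1ℚ (+ k / 1) ⟩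
  ℚ.toℚᵘ 1ℚ ℚᵘ.+ ℚ.toℚᵘ (+ k / 1)              ≈⟨ ℚᵘP.+-congʳ (ℚ.toℚᵘ 1ℚ) (ℚP.toℚᵘ-fromℚᵘ (ℚᵘ.mkℚᵘ (+ k) 0)) ⟩
  ℚᵘ.mkℚᵘ (+ 1) 0 ℚᵘ.+ ℚᵘ.mkℚᵘ (+ k) 0         ≈⟨ ℚᵘ.*≡* (cong (λ z → (+ 1 ℤ.+ z) ℤ.* + 1) (ℤP.*-identityʳ (+ k))) ⟩
  ℚᵘ.mkℚᵘ (+ suc k) 0                          ≈⟨ ℚP.toℚᵘ-fromℚᵘ (ℚᵘ.mkℚᵘ (+ suc k) 0) ⟨
  ℚ.toℚᵘ (+ suc k / 1)                         ∎))
  where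
  open ℚᵘP.≃-Reasoning

ι-sum : ∀ {n} (f : Fin n → ℕ) → sum (ι ∘ f) ≡ ι (sumℕ f)
ι-sum {zero}  f = refl
ι-sum {suc n} f = trans (+-congˡ (ι (f zero)) (ι-sum (f ∘ suc))) (sym (ι-+ (f zero) _))

sumℚ-++ : (xs ys : List ℚ) → sumℚ (xs ++ ys) ≡ sumℚ xs + sumℚ ys
sumℚ-++ []       ys = sym (ℚP.+-identityˡ _)
sumℚ-++ (x ∷ xs) ys = trans (+-congˡ x (sumℚ-++ xs ys)) (sym (ℚP.+-assoc x _ _))

module _ {A : Set} where

  Σℚ : (A → ℚ) → List A → ℚ
  Σℚ f xs = sumℚ (List.map f xs)

  Σℚ-*ˡ : ∀ r (f : A → ℚ) xs → Σℚ (λ x → r * f x) xs ≡ r * Σℚ f xs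
  Σℚ-*ˡ r f []       = sym (ℚP.*-zeroʳ r)
  Σℚ-*ˡ r f (x ∷ xs) = trans (+-congˡ (r * f x) (Σℚ-*ˡ r f xs)) (sym (ℚP.*-distribˡ-+ r (f x) _))

  Σℚ-cong : {f g : A → ℚ} → (∀ x → f x ≡ g x) → ∀ xs → Σℚ f xs ≡ Σℚ g xs
  Σℚ-cong h xs = cong sumℚ (ListP.map-cong h xs)

  Σℚ-sum : ∀ {n} (f : Fin n → A → ℚ) xs →
           Σℚ (λ x → sum (λ w → f w x)) xs ≡ sum (λ w → Σℚ (f w) xs)
  Σℚ-sum {n} f []       = sym (sum-replicate-zero n)
  Σℚ-sum {n} f (x ∷ xs) = trans (+-congˡ (sum (λ w → f w x)) (Σℚ-sum f xs))
                                (sym (∑-distrib-+ (λ w → f w x) (λ w → Σℚ (f w) xs)))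

-- Signed sums over subsets

-- Decides S ⊆ A for a 0/1 point `A`. Then `𝟙 (incl A S)` is the product of the coordinates of `A`
-- over S, that is, the entry y_S of the lifted vector of an integral point.
incl : ∀ {n} → (Fin n → Bool) → Subset n → Bool
incl A []      = true
incl A (s ∷ S) = (not s ∨ A zero) ∧ incl (A ∘ suc) S

incl-⊥ : ∀ {n} (A : Fin n → Bool) → incl A Sub.⊥ ≡ true
incl-⊥ {zero}  A = refl
incl-⊥ {suc n} A = incl-⊥ (A ∘ suc)

incl-⁅⁆ : ∀ {n} (A : Fin n → Bool) i → incl A ⁅ i ⁆ ≡ A i
incl-⁅⁆ A zero    rewrite incl-⊥ (A ∘ suc) = BoolP.∧-identityʳ (A zero)
incl-⁅⁆ A (suc i) = incl-⁅⁆ (A ∘ suc) i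

incl-∪ : ∀ {n} (A : Fin n → Bool) (S T : Subset n) → incl A (S ∪ T) ≡ incl A S ∧ incl A T
incl-∪ A []      []      = refl
incl-∪ A (s ∷ S) (t ∷ T) rewrite incl-∪ (A ∘ suc) S T =
  interchange s t (A zero) (incl (A ∘ suc) S) (incl (A ∘ suc) T)
  where
  interchange : ∀ s t a x y → (not (s ∨ t) ∨ a) ∧ (x ∧ y) ≡ ((not s ∨ a) ∧ x) ∧ ((not t ∨ a) ∧ y)
  interchange true  true  true  x     y = refl
  interchange true  false true  x     y = refl
  interchange false true  true  x     y = refl
  interchange false false true  x     y = refl
  interchange true  true  false x     y = refl
  interchange true  false false x     y = refl
  interchange false true  false true  y = refl
  interchange false true  false false y = refl
  interchange false false false x     y = refl

filter-outside : ∀ {n} q (Q : Subset n) (Ts : List (Subset n)) →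
  filter (_⊆? (q ∷ Q)) (List.map (outside ∷_) Ts) ≡ List.map (outside ∷_) (filter (_⊆? Q) Ts)
filter-outside q Q []       = refl
filter-outside q Q (T ∷ Ts) with does (T ⊆? Q)
... | true  = cong (_ ∷_) (filter-outside q Q Ts)
... | false = filter-outside q Q Ts

filter-inside : ∀ {n} (Q : Subset n) (Ts : List (Subset n)) →
  filter (_⊆? (inside ∷ Q)) (List.map (inside ∷_) Ts) ≡ List.map (inside ∷_) (filter (_⊆? Q) Ts)
filter-inside Q []       = refl
filter-inside Q (T ∷ Ts) with does (T ⊆? Q)
... | true  = cong (_ ∷_) (filter-inside Q Ts)
... | false = filter-inside Q Ts

filter-inside-outside : ∀ {n} (Q : Subset n) (Ts : List (Subset n)) →
  filter (_⊆? (outside ∷ Q)) (List.map (inside ∷_) Ts) ≡ []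
filter-inside-outside Q []       = refl
filter-inside-outside Q (T ∷ Ts) = filter-inside-outside Q Ts

subsetsOf-outside : ∀ {n} (Q : Subset n) →
  subsetsOf (outside ∷ Q) ≡ List.map (outside ∷_) (subsetsOf Q)
subsetsOf-outside {n} Q = begin
  subsetsOf (outside ∷ Q)
    ≡⟨ ListP.filter-++ (_⊆? (outside ∷ Q)) (List.map (outside ∷_) (allSubsets n)) _ ⟩
  filter (_⊆? (outside ∷ Q)) (List.map (outside ∷_) (allSubsets n))
    ++ filter (_⊆? (outside ∷ Q)) (List.map (inside ∷_) (allSubsets n))
    ≡⟨ cong₂ _++_ (filter-outside outside Q (allSubsets n)) (filter-inside-outside Q (allSubsets n)) ⟩
  List.map (outside ∷_) (subsetsOf Q) ++ []
    ≡⟨ ListP.++-identityʳ _ ⟩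
  List.map (outside ∷_) (subsetsOf Q) ∎
  where
  open ≡-Reasoning

subsetsOf-inside : ∀ {n} (Q : Subset n) →
  subsetsOf (inside ∷ Q) ≡ List.map (outside ∷_) (subsetsOf Q) ++ List.map (inside ∷_) (subsetsOf Q)
subsetsOf-inside {n} Q = trans
  (ListP.filter-++ (_⊆? (inside ∷ Q)) (List.map (outside ∷_) (allSubsets n)) _)
  (cong₂ _++_ (filter-outside inside Q (allSubsets n)) (filter-inside Q (allSubsets n)))

Σℚ-map : {A B : Set} (f : B → ℚ) (g : A → B) (xs : List A) → Σℚ f (List.map g xs) ≡ Σℚ (f ∘ g) xs
Σℚ-map f g xs = cong sumℚ (sym (ListP.map-∘ xs))

-- Inclusion-exclusion: the sum expands the product of `1 - 𝟙 (A i)` over i in `Q`. Subsets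
-- containing the first element of `Q` repeat the others with the factor `- 𝟙 a`, which splits off
-- one factor `1 - 𝟙 a`.
alternating-incl : ∀ {n} (A : Fin n → Bool) (Q : Subset n) →
  Σℚ (λ T → sgn ∣ T ∣ * 𝟙 (incl A T)) (subsetsOf Q) ≡ 𝟙 (incl (not ∘ A) Q)
alternating-incl A []            = refl
alternating-incl A (outside ∷ Q) rewrite subsetsOf-outside Q =
  trans (Σℚ-map (λ T → sgn ∣ T ∣ * 𝟙 (incl A T)) (outside ∷_) (subsetsOf Q))
        (alternating-incl (A ∘ suc) Q)
alternating-incl A (inside ∷ Q) rewrite subsetsOf-inside Q = begin
  Σℚ f (List.map (outside ∷_) Ts ++ List.map (inside ∷_) Ts)
    ≡⟨ cong sumℚ (ListP.map-++ f (List.map (outside ∷_) Ts) _) ⟩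
  sumℚ (List.map f (List.map (outside ∷_) Ts) ++ List.map f (List.map (inside ∷_) Ts))
    ≡⟨ sumℚ-++ (List.map f (List.map (outside ∷_) Ts)) _ ⟩
  Σℚ f (List.map (outside ∷_) Ts) + Σℚ f (List.map (inside ∷_) Ts)
    ≡⟨ cong₂ _+_ (Σℚ-map f (outside ∷_) Ts) (Σℚ-map f (inside ∷_) Ts) ⟩
  Σℚ g Ts + Σℚ (λ T → - sgn ∣ T ∣ * 𝟙 (a ∧ incl A′ T)) Ts
    ≡⟨ +-congˡ (Σℚ g Ts) (trans (Σℚ-cong extract Ts) (Σℚ-*ˡ (- 𝟙 a) g Ts)) ⟩
  Σℚ g Ts + - 𝟙 a * Σℚ g Ts
    ≡⟨ cong (λ x → x + - 𝟙 a * x) (alternating-incl A′ Q) ⟩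
  𝟙 B + - 𝟙 a * 𝟙 B
    ≡⟨ solve 2 (λ a b → b :+ :- a :* b := (con 1ℚ :- a) :* b) refl (𝟙 a) (𝟙 B) ⟩
  (1ℚ - 𝟙 a) * 𝟙 B
    ≡⟨ cong (_* 𝟙 B) (𝟙-not a) ⟨
  𝟙 (not a) * 𝟙 B
    ≡⟨ 𝟙-∧ (not a) B ⟨
  𝟙 (not a ∧ B) ∎
  where
  open ≡-Reasoning
  open +-*-Solver
  Ts = subsetsOf Q
  a = A zero
  A′ = A ∘ suc
  B = incl (not ∘ A′) Q
  f = λ T → sgn ∣ T ∣ * 𝟙 (incl A T)
  g = λ T → sgn ∣ T ∣ * 𝟙 (incl A′ T)
  extract : ∀ T → - sgn ∣ T ∣ * 𝟙 (a ∧ incl A′ T) ≡ - 𝟙 a * g T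
  extract T = trans (*-congˡ (- sgn ∣ T ∣) (𝟙-∧ a (incl A′ T)))
    (solve 3 (λ s a b → :- s :* (a :* b) := :- a :* (s :* b)) refl (sgn ∣ T ∣) (𝟙 a) (𝟙 (incl A′ T)))

1-𝟙-∧ : ∀ x y → 1ℚ - 𝟙 (x ∧ y) ≤ (1ℚ - 𝟙 x) + (1ℚ - 𝟙 y)
1-𝟙-∧ true  true  = ℚP.≤-refl
1-𝟙-∧ true  false = ℚP.≤-refl
1-𝟙-∧ false true  = ℚP.≤-refl
1-𝟙-∧ false false = ℚP.≤ᵇ⇒≤ _

-- Each coordinate i has one owner `o i`, and only the owner's point may differ from `B₀` at i. As S
-- lies in `B₀`, a point can fail to contain S only by owning an element of S, and S has at most
-- `∣ S ∣` owners.
union-bound : ∀ {N n} (o : Fin N → Fin n) (B₀ : Fin N → Bool) (B : Fin n → Fin N → Bool) →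
  (∀ g i → o i ≢ g → B g i ≡ B₀ i) →
  ∀ S → incl B₀ S ≡ true → sum (λ g → 1ℚ - 𝟙 (incl (B g) S)) ≤ ι ∣ S ∣
union-bound {n = n} o B₀ B agree []      h = ℚP.≤-reflexive (sum-replicate-zero n)
union-bound {n = n} o B₀ B agree (outside ∷ S) h =
  union-bound (o ∘ suc) (B₀ ∘ suc) (λ g → B g ∘ suc) (λ g i → agree g (suc i)) S h
union-bound {n = n} o B₀ B agree (inside ∷ S) h with B₀ zero in eq
... | true = begin
  sum (λ g → 1ℚ - 𝟙 (B g zero ∧ incl (B g ∘ suc) S))
    ≤⟨ sum-mono (λ g → ℚP.≤-trans (1-𝟙-∧ (B g zero) (incl (B g ∘ suc) S)) (ℚP.+-monoˡ-≤ _ (only-owner g))) ⟩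
  sum (λ g → 1ℚ * 𝟙 (does (g Fin.≟ o zero)) + (1ℚ - 𝟙 (incl (B g ∘ suc) S)))
    ≡⟨ ∑-distrib-+ (λ g → 1ℚ * 𝟙 (does (g Fin.≟ o zero))) (λ g → 1ℚ - 𝟙 (incl (B g ∘ suc) S)) ⟩
  sum (λ g → 1ℚ * 𝟙 (does (g Fin.≟ o zero))) + sum (λ g → 1ℚ - 𝟙 (incl (B g ∘ suc) S))
    ≡⟨ cong (_+ sum (λ g → 1ℚ - 𝟙 (incl (B g ∘ suc) S))) (sum-δ (o zero) (λ _ → 1ℚ)) ⟩
  1ℚ + sum (λ g → 1ℚ - 𝟙 (incl (B g ∘ suc) S))
    ≤⟨ ℚP.+-monoʳ-≤ 1ℚ (union-bound (o ∘ suc) (B₀ ∘ suc) (λ g → B g ∘ suc) (λ g i → agree g (suc i)) S h) ⟩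
  1ℚ + ι ∣ S ∣ ∎
  where
  open ℚP.≤-Reasoning
  only-owner : ∀ g → 1ℚ - 𝟙 (B g zero) ≤ 1ℚ * 𝟙 (does (g Fin.≟ o zero))
  only-owner g with g Fin.≟ o zero
  ... | no g≢o rewrite agree g zero (g≢o ∘ sym) | eq = ℚP.≤-refl
  ... | yes _ with B g zero
  ...   | true  = ℚP.≤ᵇ⇒≤ _
  ...   | false = ℚP.≤-refl

1/suc-nonneg : ∀ k → 0ℚ ≤ + 1 / suc k
1/suc-nonneg k = ℚP.nonNegative⁻¹ _ ⦃ ℚP.normalize-nonNeg 1 (suc k) ⦄

1/suc-inverse : ∀ k → (+ 1 / suc k) * ι (suc k) ≡ 1ℚ
1/suc-inverse k = trans (*-congˡ (+ 1 / suc k) (ι≡/1 (suc k))) (ℚP.toℚᵘ-injective (begin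
  ℚ.toℚᵘ ((+ 1 / suc k) * (+ suc k / 1))
    ≈⟨ ℚP.toℚᵘ-homo-* (+ 1 / suc k) (+ suc k / 1) ⟩
  ℚ.toℚᵘ (+ 1 / suc k) ℚᵘ.* ℚ.toℚᵘ (+ suc k / 1)
    ≈⟨ ℚᵘP.*-cong (ℚP.toℚᵘ-fromℚᵘ (ℚᵘ.mkℚᵘ (+ 1) k)) (ℚP.toℚᵘ-fromℚᵘ (ℚᵘ.mkℚᵘ (+ suc k) 0)) ⟩
  ℚᵘ.mkℚᵘ (+ 1) k ℚᵘ.* ℚᵘ.mkℚᵘ (+ suc k) 0
    ≈⟨ ℚᵘ.*≡* (cong +_ (cong suc (trans (cong (ℕ._* 1) (ℕP.+-identityʳ k)) (sym (ℕP.+-identityʳ _))))) ⟩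
  ℚ.toℚᵘ 1ℚ ∎))
  where
  open ℚᵘP.≃-Reasoning

-- Sherali–Adams solutions from signed mixtures of 0/1 points

-- A 0/1 point is given by a successor function `s` and has support the arcs u → s u. Each tail has
-- exactly one chosen head, so a linear form on all pairs collapses to one term per vertex.
edge-sum : ∀ {ν} (a : Fin (ν ℕ.* ν) → ℚ) (s : Fin ν → Fin ν) →
  sum (λ i → a i * 𝟙 (does (headV ν i Fin.≟ s (tailV ν i)))) ≡ sum (λ u → a (combine u (s u)))
edge-sum {ν} a s = trans (sum-combine ν _) (sum-cong-≗ row)
  where
  row : ∀ u → sum (λ v → a (combine u v) *
                 𝟙 (does (headV ν (combine u v) Fin.≟ s (tailV ν (combine u v))))) ≡ a (combine u (s u))
  row u = trans (sum-cong-≗ cell) (sum-δ (s u) (λ v → a (combine u v)))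
    where
    cell : ∀ v → a (combine u v) * 𝟙 (does (headV ν (combine u v) Fin.≟ s (tailV ν (combine u v))))
               ≡ a (combine u v) * 𝟙 (does (v Fin.≟ s u))
    cell v = cong (λ p → a (combine u v) * 𝟙 (does (proj₂ p Fin.≟ s (proj₁ p)))) (FinP.remQuot-combine u v)

module Mixture {N m : ℕ} (α : Fin m → ℚ) (A : Fin m → Fin N → Bool) where

  -- The weights may have either sign; the identities of this module are linear in them.
  mix : Subset N → ℚ
  mix S = sum (λ w → α w * 𝟙 (incl (A w) S))

  -- The event that a Sherali-Adams constraint conditions on: world `w` uses every edge of S and
  -- none of Q.
  κ : Subset N → Subset N → Fin m → Bool
  κ S Q w = incl (A w) S ∧ incl (not ∘ A w) Q

  exchange : ∀ (F : Fin m → Subset N → ℚ) Ts →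
    Σℚ (λ T → sgn ∣ T ∣ * sum (λ w → α w * F w T)) Ts ≡
    sum (λ w → α w * Σℚ (λ T → sgn ∣ T ∣ * F w T) Ts)
  exchange F Ts = begin
    Σℚ (λ T → sgn ∣ T ∣ * sum (λ w → α w * F w T)) Ts
      ≡⟨ Σℚ-cong (λ T → trans (*-distribˡ-sum (sgn ∣ T ∣) (λ w → α w * F w T))
                              (sum-cong-≗ (λ w → swap (sgn ∣ T ∣) (α w) (F w T)))) Ts ⟩
    Σℚ (λ T → sum (λ w → α w * (sgn ∣ T ∣ * F w T))) Ts
      ≡⟨ Σℚ-sum (λ w T → α w * (sgn ∣ T ∣ * F w T)) Ts ⟩
    sum (λ w → Σℚ (λ T → α w * (sgn ∣ T ∣ * F w T)) Ts)
      ≡⟨ sum-cong-≗ (λ w → Σℚ-*ˡ (α w) (λ T → sgn ∣ T ∣ * F w T) Ts) ⟩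
    sum (λ w → α w * Σℚ (λ T → sgn ∣ T ∣ * F w T) Ts) ∎
    where
    open ≡-Reasoning
    swap : ∀ x y z → x * (y * z) ≡ y * (x * z)
    swap = solve 3 (λ x y z → x :* (y :* z) := y :* (x :* z)) refl
      where
      open +-*-Solver

  -- The factor `x` does not depend on T and passes through the signed sum. It is 1 for `altSum-mix`
  -- and the coordinate `𝟙 (A w i)` for `saLHS-mix`.
  conditional : ∀ (B : Fin N → Bool) S Q x →
    Σℚ (λ T → sgn ∣ T ∣ * ((𝟙 (incl B S) * x) * 𝟙 (incl B T))) (subsetsOf Q) ≡
    𝟙 (incl B S ∧ incl (not ∘ B) Q) * x
  conditional B S Q x = begin
    Σℚ (λ T → sgn ∣ T ∣ * ((p * x) * 𝟙 (incl B T))) (subsetsOf Q)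
      ≡⟨ Σℚ-cong (λ T → swap (sgn ∣ T ∣) (p * x) (𝟙 (incl B T))) (subsetsOf Q) ⟩
    Σℚ (λ T → (p * x) * (sgn ∣ T ∣ * 𝟙 (incl B T))) (subsetsOf Q)
      ≡⟨ Σℚ-*ˡ (p * x) (λ T → sgn ∣ T ∣ * 𝟙 (incl B T)) (subsetsOf Q) ⟩
    (p * x) * Σℚ (λ T → sgn ∣ T ∣ * 𝟙 (incl B T)) (subsetsOf Q)
      ≡⟨ *-congˡ (p * x) (alternating-incl B Q) ⟩
    (p * x) * 𝟙 (incl (not ∘ B) Q)
      ≡⟨ rearrange p x (𝟙 (incl (not ∘ B) Q)) ⟩
    (p * 𝟙 (incl (not ∘ B) Q)) * x
      ≡⟨ cong (_* x) (𝟙-∧ (incl B S) (incl (not ∘ B) Q)) ⟨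
    𝟙 (incl B S ∧ incl (not ∘ B) Q) * x ∎
    where
    open ≡-Reasoning
    p = 𝟙 (incl B S)
    open +-*-Solver
    swap : ∀ x y z → x * (y * z) ≡ y * (x * z)
    swap = solve 3 (λ x y z → x :* (y :* z) := y :* (x :* z)) refl
    rearrange : ∀ x y z → (x * y) * z ≡ (x * z) * y
    rearrange = solve 3 (λ x y z → (x :* y) :* z := (x :* z) :* y) refl

  altSum-mix : ∀ S Q → altSum mix S Q ≡ sum (λ w → α w * 𝟙 (κ S Q w))
  altSum-mix S Q = trans (exchange (λ w T → 𝟙 (incl (A w) (S ∪ T))) (subsetsOf Q))
    (sum-cong-≗ λ w → *-congˡ (α w) (trans (Σℚ-cong (split w) (subsetsOf Q))
      (trans (conditional (A w) S Q 1ℚ) (ℚP.*-identityʳ (𝟙 (κ S Q w))))))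
    where
    split : ∀ w T → sgn ∣ T ∣ * 𝟙 (incl (A w) (S ∪ T))
                  ≡ sgn ∣ T ∣ * ((𝟙 (incl (A w) S) * 1ℚ) * 𝟙 (incl (A w) T))
    split w T = *-congˡ (sgn ∣ T ∣) (trans (cong 𝟙 (incl-∪ (A w) S T))
      (trans (𝟙-∧ (incl (A w) S) (incl (A w) T))
             (cong (_* 𝟙 (incl (A w) T)) (sym (ℚP.*-identityʳ (𝟙 (incl (A w) S)))))))

  -- Once the sums are exchanged, the signed sum over T collapses world by world. A lifted
  -- constraint thus becomes the weighted sum of the original one over the worlds that survive
  -- conditioning.
  saLHS-mix : ∀ a S Q →
    saLHS a mix S Q ≡ sum (λ w → α w * (𝟙 (κ S Q w) * sum (λ i → a i * 𝟙 (A w i))))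
  saLHS-mix a S Q = begin
    saLHS a mix S Q
      ≡⟨ sum-allFin (λ i → a i * Σℚ (λ T → sgn ∣ T ∣ * mix (S ∪ T ∪ ⁅ i ⁆)) (subsetsOf Q)) ⟩
    sum (λ i → a i * Σℚ (λ T → sgn ∣ T ∣ * mix (S ∪ T ∪ ⁅ i ⁆)) (subsetsOf Q))
      ≡⟨ sum-cong-≗ (λ i → *-congˡ (a i) (coordinate i)) ⟩
    sum (λ i → a i * sum (λ w → α w * (𝟙 (κ S Q w) * 𝟙 (A w i))))
      ≡⟨ sum-cong-≗ (λ i → trans (*-distribˡ-sum (a i) (λ w → α w * (𝟙 (κ S Q w) * 𝟙 (A w i))))
           (sum-cong-≗ (λ w → rearrange (a i) (α w) (𝟙 (κ S Q w)) (𝟙 (A w i))))) ⟩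
    sum (λ i → sum (λ w → α w * 𝟙 (κ S Q w) * (a i * 𝟙 (A w i))))
      ≡⟨ ∑-comm (λ i w → α w * 𝟙 (κ S Q w) * (a i * 𝟙 (A w i))) ⟩
    sum (λ w → sum (λ i → α w * 𝟙 (κ S Q w) * (a i * 𝟙 (A w i))))
      ≡⟨ sum-cong-≗ (λ w → trans (sym (*-distribˡ-sum (α w * 𝟙 (κ S Q w)) (λ i → a i * 𝟙 (A w i))))
           (ℚP.*-assoc (α w) (𝟙 (κ S Q w)) (sum (λ i → a i * 𝟙 (A w i))))) ⟩
    sum (λ w → α w * (𝟙 (κ S Q w) * sum (λ i → a i * 𝟙 (A w i)))) ∎
    where
    open ≡-Reasoning
    rearrange : ∀ x y z w → x * (y * (z * w)) ≡ (y * z) * (x * w)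
    rearrange = solve 4 (λ x y z w → x :* (y :* (z :* w)) := (y :* z) :* (x :* w)) refl
      where
      open +-*-Solver
    split : ∀ i w T → sgn ∣ T ∣ * 𝟙 (incl (A w) (S ∪ T ∪ ⁅ i ⁆))
                    ≡ sgn ∣ T ∣ * ((𝟙 (incl (A w) S) * 𝟙 (A w i)) * 𝟙 (incl (A w) T))
    split i w T = *-congˡ (sgn ∣ T ∣) (begin
      𝟙 (incl (A w) (S ∪ (T ∪ ⁅ i ⁆)))
        ≡⟨ cong 𝟙 (incl-∪ (A w) S (T ∪ ⁅ i ⁆)) ⟩
      𝟙 (incl (A w) S ∧ incl (A w) (T ∪ ⁅ i ⁆))
        ≡⟨ 𝟙-∧ (incl (A w) S) _ ⟩
      𝟙 (incl (A w) S) * 𝟙 (incl (A w) (T ∪ ⁅ i ⁆))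
        ≡⟨ *-congˡ (𝟙 (incl (A w) S)) (trans (cong 𝟙 (incl-∪ (A w) T ⁅ i ⁆)) (𝟙-∧ (incl (A w) T) _)) ⟩
      𝟙 (incl (A w) S) * (𝟙 (incl (A w) T) * 𝟙 (incl (A w) ⁅ i ⁆))
        ≡⟨ cong (λ b → 𝟙 (incl (A w) S) * (𝟙 (incl (A w) T) * 𝟙 b)) (incl-⁅⁆ (A w) i) ⟩
      𝟙 (incl (A w) S) * (𝟙 (incl (A w) T) * 𝟙 (A w i))
        ≡⟨ solve 3 (λ x y z → x :* (y :* z) := (x :* z) :* y) refl (𝟙 (incl (A w) S)) (𝟙 (incl (A w) T)) (𝟙 (A w i)) ⟩
      (𝟙 (incl (A w) S) * 𝟙 (A w i)) * 𝟙 (incl (A w) T) ∎)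
      where
      open +-*-Solver
    coordinate : ∀ i → Σℚ (λ T → sgn ∣ T ∣ * mix (S ∪ T ∪ ⁅ i ⁆)) (subsetsOf Q)
                     ≡ sum (λ w → α w * (𝟙 (κ S Q w) * 𝟙 (A w i)))
    coordinate i = trans (exchange (λ w T → 𝟙 (incl (A w) (S ∪ T ∪ ⁅ i ⁆))) (subsetsOf Q))
      (sum-cong-≗ λ w → *-congˡ (α w) (trans (Σℚ-cong (split i w) (subsetsOf Q))
        (conditional (A w) S Q (𝟙 (A w i)))))

𝟙-*-≤ : ∀ b {x y} → x ≤ y → 0ℚ ≤ y → 𝟙 b * x ≤ y
𝟙-*-≤ true  {x} {y} x≤y _ = subst (_≤ y) (sym (ℚP.*-identityˡ x)) x≤y
𝟙-*-≤ false {x} {y} _ 0≤y = subst (_≤ y) (sym (ℚP.*-zeroˡ x)) 0≤y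

p-q≤p : ∀ {p q} → 0ℚ ≤ q → p - q ≤ p
p-q≤p {p} {q} 0≤q = 0≤q-p⇒p≤q (subst (0ℚ ≤_) (solve 2 (λ p q → q := p :- (p :- q)) refl p q) 0≤q)
  where
  open +-*-Solver

value : ∀ {ν} → (Fin (ν ℕ.* ν) → ℚ) → (Fin ν → Fin ν) → ℚ
value a s = sum (λ u → a (combine u (s u)))

module Extrapolation {ν n t : ℕ} (t+2≤n : 2 ℕ.+ t ℕ.≤ n)
  (σ ρ : Fin ν → Fin ν) (τ : Fin ν → Fin n) where

  r : ℚ
  r = + 1 / (2 ℕ.+ t)

  -- World `zero` is the cycle cover C and world `suc g` is H_g. A vertex `u` switches from `σ` to
  -- `ρ` in the single world of its gap `τ u`, which is how the disjointness of the exchanges is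
  -- encoded.
  world : Fin (suc n) → Fin ν → Fin ν
  world zero    u = σ u
  world (suc g) u = if does (g Fin.≟ τ u) then ρ u else σ u

  -- With M = t + 2 and `r` = 1/M, the first weight is 1 - n/M, which is nonpositive because M ≤ n.
  weight : Fin (suc n) → ℚ
  weight zero    = r * (ι (2 ℕ.+ t) - ι n)
  weight (suc g) = r

  arcs : Fin (suc n) → Fin (ν ℕ.* ν) → Bool
  arcs w i = does (headV ν i Fin.≟ world w (tailV ν i))

  open Mixture weight arcs public

  total-weight : sum weight ≡ 1ℚ
  total-weight = begin
    r * (ι (2 ℕ.+ t) - ι n) + sum {n} (λ _ → r)
      ≡⟨ cong (λ x → r * (ι (2 ℕ.+ t) - ι n) + x)
           (trans (sum-cong-≗ {n} (λ _ → sym (ℚP.*-identityʳ r)))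
             (trans (sym (*-distribˡ-sum {n} r (λ _ → 1ℚ))) (*-congˡ r (sum-one n)))) ⟩
    r * (ι (2 ℕ.+ t) - ι n) + r * ι n
      ≡⟨ solve 3 (λ r m n → r :* (m :- n) :+ r :* n := r :* m) refl r (ι (2 ℕ.+ t)) (ι n) ⟩
    r * ι (2 ℕ.+ t)
      ≡⟨ 1/suc-inverse (suc t) ⟩
    1ℚ ∎
    where
    open ≡-Reasoning
    open +-*-Solver

  mix-⊥ : mix Sub.⊥ ≡ 1ℚ
  mix-⊥ = trans (sum-cong-≗ (λ w → trans (cong (λ b → weight w * 𝟙 b) (incl-⊥ (arcs w)))
    (ℚP.*-identityʳ (weight w)))) total-weight

  -- A vertex `u` departs from `σ` only in world `suc (τ u)`. After exchanging the sums, a single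
  -- `g` remains for each `u`, so no exchange is counted twice.
  switch-gain : ∀ a (k : Fin n → Bool) →
    sum (λ g → 𝟙 (k g) * (value a σ - value a (world (suc g)))) ≡
    sum (λ u → 𝟙 (k (τ u)) * (a (combine u (σ u)) - a (combine u (ρ u))))
  switch-gain a k = begin
    sum (λ g → 𝟙 (k g) * (value a σ - value a (world (suc g))))
      ≡⟨ sum-cong-≗ (λ g → trans (*-congˡ (𝟙 (k g)) (local g))
           (*-distribˡ-sum (𝟙 (k g)) (λ u → gain u * 𝟙 (does (g Fin.≟ τ u))))) ⟩
    sum (λ g → sum (λ u → 𝟙 (k g) * (gain u * 𝟙 (does (g Fin.≟ τ u)))))
      ≡⟨ ∑-comm (λ g u → 𝟙 (k g) * (gain u * 𝟙 (does (g Fin.≟ τ u)))) ⟩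
    sum (λ u → sum (λ g → 𝟙 (k g) * (gain u * 𝟙 (does (g Fin.≟ τ u)))))
      ≡⟨ sum-cong-≗ (λ u → trans
           (sum-cong-≗ (λ g → sym (ℚP.*-assoc (𝟙 (k g)) (gain u) (𝟙 (does (g Fin.≟ τ u))))))
           (sum-δ (τ u) (λ g → 𝟙 (k g) * gain u))) ⟩
    sum (λ u → 𝟙 (k (τ u)) * gain u) ∎
    where
    open ≡-Reasoning
    open +-*-Solver
    gain : Fin ν → ℚ
    gain u = a (combine u (σ u)) - a (combine u (ρ u))
    pointwise : ∀ g u → a (combine u (σ u)) - a (combine u (world (suc g) u))
                      ≡ gain u * 𝟙 (does (g Fin.≟ τ u))
    pointwise g u with does (g Fin.≟ τ u)
    ... | true  = sym (ℚP.*-identityʳ (gain u))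
    ... | false = trans (ℚP.+-inverseʳ (a (combine u (σ u)))) (sym (ℚP.*-zeroʳ (gain u)))
    local : ∀ g → value a σ - value a (world (suc g)) ≡ sum (λ u → gain u * 𝟙 (does (g Fin.≟ τ u)))
    local g = trans (sym (sum-minus (λ u → a (combine u (σ u))) (λ u → a (combine u (world (suc g) u)))))
                    (sum-cong-≗ (pointwise g))

  slack : (Fin (ν ℕ.* ν) → ℚ) → ℚ → Fin (suc n) → ℚ
  slack a b w = value a (world w) - b

  -- The bound is required for every set k of surviving worlds, since conditioning may discard any few of them.
  LocallyValid : (Fin (ν ℕ.* ν) → ℚ) → ℚ → Set
  LocallyValid a b = (∀ g → 0ℚ ≤ slack a b (suc g)) ×
    (slack a b zero ≤ 0ℚ ⊎
     (0ℚ ≤ slack a b zero ×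
      (∀ (k : Fin n → Bool) → sum (λ u → 𝟙 (k (τ u)) * (a (combine u (σ u)) - a (combine u (ρ u))))
           ≤ slack a b zero + slack a b zero)))

  -- A world is discarded by missing an edge of S or by using one of Q. Since C survives,
  -- `union-bound` applies to the arc sets for S and to their complements for Q.
  killed-≤ : ∀ S Q → κ S Q zero ≡ true →
    sum (λ g → 1ℚ - 𝟙 (κ S Q (suc g))) ≤ ι (∣ S ∣ ℕ.+ ∣ Q ∣)
  killed-≤ S Q h = begin
    sum (λ g → 1ℚ - 𝟙 (κ S Q (suc g)))
      ≤⟨ sum-mono (λ g → 1-𝟙-∧ (incl (arcs (suc g)) S) (incl (not ∘ arcs (suc g)) Q)) ⟩
    sum (λ g → (1ℚ - 𝟙 (incl (arcs (suc g)) S)) + (1ℚ - 𝟙 (incl (not ∘ arcs (suc g)) Q)))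
      ≡⟨ ∑-distrib-+ (λ g → 1ℚ - 𝟙 (incl (arcs (suc g)) S)) (λ g → 1ℚ - 𝟙 (incl (not ∘ arcs (suc g)) Q)) ⟩
    sum (λ g → 1ℚ - 𝟙 (incl (arcs (suc g)) S)) + sum (λ g → 1ℚ - 𝟙 (incl (not ∘ arcs (suc g)) Q))
      ≤⟨ ℚP.+-mono-≤
           (union-bound (τ ∘ tailV ν) (arcs zero) (arcs ∘ suc) agree S (proj₁ (split h)))
           (union-bound (τ ∘ tailV ν) (not ∘ arcs zero) (λ g → not ∘ arcs (suc g))
             (λ g i ne → cong not (agree g i ne)) Q (proj₂ (split h))) ⟩
    (ι ∣ S ∣) + (ι ∣ Q ∣)
      ≡⟨ ι-+ ∣ S ∣ ∣ Q ∣ ⟨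
    ι (∣ S ∣ ℕ.+ ∣ Q ∣) ∎
    where
    open ℚP.≤-Reasoning
    split : ∀ {x y} → x ∧ y ≡ true → x ≡ true × y ≡ true
    split {true} {true} _ = refl , refl
    agree : ∀ g i → τ (tailV ν i) ≢ g → arcs (suc g) i ≡ arcs zero i
    agree g i ne rewrite dec-false (g Fin.≟ τ (tailV ν i)) (ne ∘ sym) = refl

  -- If C is discarded, only nonnegative terms remain. If its slack `s₀` is nonpositive, its
  -- nonpositive weight makes the product nonnegative. Otherwise the multiples of n cancel and M = t
  -- + 2 copies of `s₀` are left: t of them pay for the discarded worlds, and two for the gains of
  -- the surviving exchanges.
  weighted-slack-nonneg : ∀ {a b} → LocallyValid a b → ∀ S Q → ∣ S ∣ ℕ.+ ∣ Q ∣ ℕ.≤ t →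
    0ℚ ≤ sum (λ w → weight w * (𝟙 (κ S Q w) * slack a b w))
  weighted-slack-nonneg {a} {b} (valid , base) S Q small =
    subst (0ℚ ≤_) (sym factor) (*-nonneg (1/suc-nonneg (suc t)) (inner (κ S Q zero) refl base))
    where
    open +-*-Solver
    M = ι (2 ℕ.+ t)
    s₀ = slack a b zero
    k : Fin n → ℚ
    k g = 𝟙 (κ S Q (suc g))
    s : Fin n → ℚ
    s g = slack a b (suc g)
    v : Fin n → ℚ
    v g = value a σ - value a (world (suc g))

    factor : sum (λ w → weight w * (𝟙 (κ S Q w) * slack a b w)) ≡
             r * ((M - ι n) * (𝟙 (κ S Q zero) * s₀) + sum (λ g → k g * s g))
    factor = trans (+-congˡ (r * (M - ι n) * (𝟙 (κ S Q zero) * s₀)) (sym (*-distribˡ-sum r (λ g → k g * s g))))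
      (solve 4 (λ r x y z → r :* x :* y :+ r :* z := r :* (x :* y :+ z)) refl
        r (M - ι n) (𝟙 (κ S Q zero) * s₀) (sum (λ g → k g * s g)))

    rest-nonneg : 0ℚ ≤ sum (λ g → k g * s g)
    rest-nonneg = sum-nonneg (λ g → *-nonneg (𝟙-nonneg (κ S Q (suc g))) (valid g))

    -- v g = s₀ - s g, so κ_g s_g = s₀ - (1 - κ_g) s₀ - κ_g v_g: the second sum is at most t s₀, the third at most 2 s₀.
    expand : sum (λ g → k g * s g) ≡ ι n * s₀ - sum (λ g → 1ℚ - k g) * s₀ - sum (λ g → k g * v g)
    expand = begin
      sum (λ g → k g * s g)
        ≡⟨ sum-cong-≗ (λ g → pointwise (k g) (value a σ) (value a (world (suc g))) b) ⟩
      sum (λ g → 1ℚ * s₀ - (1ℚ - k g) * s₀ - k g * v g)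
        ≡⟨ sum-minus (λ g → 1ℚ * s₀ - (1ℚ - k g) * s₀) (λ g → k g * v g) ⟩
      sum (λ g → 1ℚ * s₀ - (1ℚ - k g) * s₀) - sum (λ g → k g * v g)
        ≡⟨ cong (_- sum (λ g → k g * v g)) (trans (sum-minus {n} (λ _ → 1ℚ * s₀) (λ g → (1ℚ - k g) * s₀))
             (cong₂ _-_ (trans (sym (*-distribʳ-sum {n} s₀ (λ _ → 1ℚ))) (cong (_* s₀) (sum-one n)))
                        (sym (*-distribʳ-sum s₀ (λ g → 1ℚ - k g))))) ⟩
      ι n * s₀ - sum (λ g → 1ℚ - k g) * s₀ - sum (λ g → k g * v g) ∎
      where
      open ≡-Reasoning
      pointwise : ∀ k x y b → k * (y - b) ≡ 1ℚ * (x - b) - (1ℚ - k) * (x - b) - k * (x - y)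
      pointwise = solve 4 (λ k x y b → k :* (y :- b) :=
        con 1ℚ :* (x :- b) :- (con 1ℚ :- k) :* (x :- b) :- k :* (x :- y)) refl

    inner : ∀ k₀ → κ S Q zero ≡ k₀ →
      (s₀ ≤ 0ℚ ⊎ (0ℚ ≤ s₀ × (∀ (k : Fin n → Bool) → sum (λ u → 𝟙 (k (τ u)) * (a (combine u (σ u)) - a (combine u (ρ u)))) ≤ s₀ + s₀))) →
      0ℚ ≤ (M - ι n) * (𝟙 (κ S Q zero) * s₀) + sum (λ g → k g * s g)
    inner false eq _ rewrite eq = subst (0ℚ ≤_) (sym (trans
      (cong (_+ sum (λ g → k g * s g)) (trans (*-congˡ (M - ι n) (ℚP.*-zeroˡ s₀)) (ℚP.*-zeroʳ (M - ι n))))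
      (ℚP.+-identityˡ _))) rest-nonneg
    inner true eq (inj₁ s₀≤0) rewrite eq = ℚP.+-mono-≤ (subst (0ℚ ≤_)
      (solve 3 (λ m n s → (n :- m) :* (con 0ℚ :- s) := (m :- n) :* (con 1ℚ :* s)) refl M (ι n) s₀)
      (*-nonneg (p≤q⇒0≤q-p (ι-mono t+2≤n)) (p≤q⇒0≤q-p s₀≤0))) rest-nonneg
    inner true eq (inj₂ (0≤s₀ , bound)) rewrite eq = subst (0ℚ ≤_) (sym regroup)
      (ℚP.+-mono-≤ (*-nonneg (p≤q⇒0≤q-p (ℚP.≤-trans (killed-≤ S Q eq) (ι-mono small))) 0≤s₀)
                   (p≤q⇒0≤q-p (subst (_≤ s₀ + s₀) (sym (switch-gain a (κ S Q ∘ suc))) (bound (κ S Q ∘ suc)))))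
      where
      K = sum (λ g → 1ℚ - k g)
      G = sum (λ g → k g * v g)
      regroup : (M - ι n) * (1ℚ * s₀) + sum (λ g → k g * s g) ≡ (ι t - K) * s₀ + (s₀ + s₀ - G)
      regroup = trans (+-congˡ ((M - ι n) * (1ℚ * s₀)) expand)
        (solve 5 (λ t n s K G →
          (con 1ℚ :+ (con 1ℚ :+ t) :- n) :* (con 1ℚ :* s) :+ (n :* s :- K :* s :- G) :=
          (t :- K) :* s :+ (s :+ s :- G)) refl (ι t) (ι n) s₀ K G)

  LocallyValid⇒SA : ∀ {a b} → LocallyValid a b → ∀ S Q → ∣ S ∣ ℕ.+ ∣ Q ∣ ℕ.≤ t →
    b * altSum mix S Q ≤ saLHS a mix S Q
  LocallyValid⇒SA {a} {b} valid S Q small = 0≤q-p⇒p≤q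
    (subst (0ℚ ≤_) (sym difference) (weighted-slack-nonneg {a} {b} valid S Q small))
    where
    open ≡-Reasoning
    open +-*-Solver
    pointwise : ∀ α k x b → α * (k * x) - b * (α * k) ≡ α * (k * (x - b))
    pointwise = solve 4 (λ α k x b → α :* (k :* x) :- b :* (α :* k) := α :* (k :* (x :- b))) refl
    difference : saLHS a mix S Q - b * altSum mix S Q ≡
                 sum (λ w → weight w * (𝟙 (κ S Q w) * slack a b w))
    difference = begin
      saLHS a mix S Q - b * altSum mix S Q
        ≡⟨ cong₂ _-_ (trans (saLHS-mix a S Q)
                        (sum-cong-≗ (λ w → cong (λ x → weight w * (𝟙 (κ S Q w) * x)) (edge-sum a (world w)))))
                     (trans (*-congˡ b (altSum-mix S Q)) (*-distribˡ-sum b (λ w → weight w * 𝟙 (κ S Q w)))) ⟩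
      sum (λ w → weight w * (𝟙 (κ S Q w) * value a (world w))) - sum (λ w → b * (weight w * 𝟙 (κ S Q w)))
        ≡⟨ sum-minus (λ w → weight w * (𝟙 (κ S Q w) * value a (world w))) (λ w → b * (weight w * 𝟙 (κ S Q w))) ⟨
      sum (λ w → weight w * (𝟙 (κ S Q w) * value a (world w)) - b * (weight w * 𝟙 (κ S Q w)))
        ≡⟨ sum-cong-≗ (λ w → pointwise (weight w) (𝟙 (κ S Q w)) (value a (world w)) b) ⟩
      sum (λ w → weight w * (𝟙 (κ S Q w) * slack a b w)) ∎

-- The DFJ constraints

record IsCycleCover {ν} (s : Fin ν → Fin ν) : Set where
  field
    pred     : Fin ν → Fin ν
    s∘pred   : ∀ v → s (pred v) ≡ v
    pred∘s   : ∀ u → pred (s u) ≡ u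
    no-loop  : ∀ u → s u ≢ u

-- For a permutation this says that `s` is a single cycle. It is phrased with invariant sets because
-- the cut lemmas use it with `P` a side of the cut.
IsConnected : ∀ {ν} → (Fin ν → Fin ν) → Set
IsConnected {ν} s = (P : Fin ν → Bool) → (∀ u → P u ≡ true → P (s u) ≡ true) →
                    ∀ x y → P x ≡ true → P y ≡ true

lookup-⁅⁆ : ∀ {n} (v u : Fin n) → lookup ⁅ v ⁆ u ≡ does (u Fin.≟ v)
lookup-⁅⁆ zero    zero    = refl
lookup-⁅⁆ zero    (suc u) = lookup-replicate u outside
lookup-⁅⁆ (suc v) zero    = refl
lookup-⁅⁆ (suc v) (suc u) = lookup-⁅⁆ v u

∃-inside : ∀ {n} (U : Subset n) → 0 ℕ.< ∣ U ∣ → ∃ λ x → lookup U x ≡ true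
∃-inside (inside  ∷ U) _ = zero , refl
∃-inside (outside ∷ U) h = let (x , e) = ∃-inside U h in suc x , e

∃-outside : ∀ {n} (U : Subset n) → ∣ U ∣ ℕ.< n → ∃ λ x → lookup U x ≡ false
∃-outside (outside ∷ U) _ = zero , refl
∃-outside (inside  ∷ U) (s≤s h) = let (x , e) = ∃-outside U h in suc x , e

𝟙ℕ : Bool → ℕ
𝟙ℕ true  = 1
𝟙ℕ false = 0

ι-𝟙ℕ : ∀ b → ι (𝟙ℕ b) ≡ 𝟙 b
ι-𝟙ℕ true  = refl
ι-𝟙ℕ false = refl

sumℕ≡0⇒≡0 : ∀ {n} (f : Fin n → ℕ) → sumℕ f ≡ 0 → ∀ i → f i ≡ 0
sumℕ≡0⇒≡0 f eq zero    = ℕP.m+n≡0⇒m≡0 (f zero) eq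
sumℕ≡0⇒≡0 f eq (suc i) = sumℕ≡0⇒≡0 (f ∘ suc) (ℕP.m+n≡0⇒n≡0 (f zero) eq) i

count : ∀ {n} → (Fin n → Bool) → ℕ
count b = sumℕ (λ i → 𝟙ℕ (b i))

sum-𝟙 : ∀ {n} (b : Fin n → Bool) → sum (λ i → 𝟙 (b i)) ≡ ι (count b)
sum-𝟙 b = trans (sum-cong-≗ (λ i → sym (ι-𝟙ℕ (b i)))) (ι-sum (λ i → 𝟙ℕ (b i)))

count≡0⇒false : ∀ {n} (b : Fin n → Bool) → count b ≡ 0 → ∀ i → b i ≡ false
count≡0⇒false b eq i with b i | sumℕ≡0⇒≡0 (λ i → 𝟙ℕ (b i)) eq i
... | false | _ = refl

leaves enters : ∀ {ν} → Subset ν → (Fin ν → Fin ν) → Fin ν → Bool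
leaves U s u = lookup U u ∧ not (lookup U (s u))
enters U s u = not (lookup U u) ∧ lookup U (s u)

if-𝟙 : ∀ b → (if b then 1ℚ else 0ℚ) ≡ 𝟙 b
if-𝟙 true  = refl
if-𝟙 false = refl

δout-combine : ∀ {ν} (U : Subset ν) u v → δout ν U (combine u v) ≡ 𝟙 (lookup U u ∧ not (lookup U v))
δout-combine U u v = trans (if-𝟙 _)
  (cong (λ p → 𝟙 (lookup U (proj₁ p) ∧ not (lookup U (proj₂ p)))) (FinP.remQuot-combine u v))

δin-combine : ∀ {ν} (U : Subset ν) u v → δin ν U (combine u v) ≡ 𝟙 (not (lookup U u) ∧ lookup U v)
δin-combine U u v = trans (if-𝟙 _)
  (cong (λ p → 𝟙 (not (lookup U (proj₁ p)) ∧ lookup U (proj₂ p))) (FinP.remQuot-combine u v))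

value-δout : ∀ {ν} (U : Subset ν) (s : Fin ν → Fin ν) → value (δout ν U) s ≡ sum (λ u → 𝟙 (leaves U s u))
value-δout U s = sum-cong-≗ (λ u → δout-combine U u (s u))

value-δin : ∀ {ν} (U : Subset ν) (s : Fin ν → Fin ν) → value (δin ν U) s ≡ sum (λ u → 𝟙 (enters U s u))
value-δin U s = sum-cong-≗ (λ u → δin-combine U u (s u))

-- If no arc left `U`, then `U` would be a nonempty set closed under `s`, hence contain the vertex
-- outside it. For entering arcs the same argument runs on the complement.
connected⇒leaves : ∀ {ν} {s : Fin ν → Fin ν} → IsConnected s → ∀ U → 0 ℕ.< ∣ U ∣ → ∣ U ∣ ℕ.< ν →
  count (leaves U s) ≢ 0
connected⇒leaves {s = s} conn U ne pr eq
  with (x , x∈U) ← ∃-inside U ne | (y , y∉U) ← ∃-outside U pr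
  = contradiction (trans (sym y∉U) (conn (lookup U) closed x y x∈U)) λ ()
  where
  closed : ∀ u → lookup U u ≡ true → lookup U (s u) ≡ true
  closed u u∈U with lookup U u | lookup U (s u) | count≡0⇒false (leaves U s) eq u
  closed u refl | true | true | _ = refl

connected⇒enters : ∀ {ν} {s : Fin ν → Fin ν} → IsConnected s → ∀ U → 0 ℕ.< ∣ U ∣ → ∣ U ∣ ℕ.< ν →
  count (enters U s) ≢ 0
connected⇒enters {s = s} conn U ne pr eq
  with (x , x∈U) ← ∃-inside U ne | (y , y∉U) ← ∃-outside U pr
  = contradiction (trans (sym (cong not x∈U)) (conn (not ∘ lookup U) closed y x (cong not y∉U))) λ ()
  where
  closed : ∀ u → not (lookup U u) ≡ true → not (lookup U (s u)) ≡ true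
  closed u u∉U with lookup U u | lookup U (s u) | count≡0⇒false (enters U s) eq u
  closed u refl | false | false | _ = refl

sum-δ₁ : ∀ {n} (x : Fin n) → sum (λ u → 𝟙 (does (u Fin.≟ x))) ≡ 1ℚ
sum-δ₁ x = trans (sum-cong-≗ (λ u → sym (ℚP.*-identityˡ (𝟙 (does (u Fin.≟ x)))))) (sum-δ x (λ _ → 1ℚ))

degOut≡1 : ∀ {ν} {s : Fin ν → Fin ν} → IsCycleCover s → ∀ v → value (δout ν ⁅ v ⁆) s ≡ 1ℚ
degOut≡1 {s = s} cover v = trans (value-δout ⁅ v ⁆ s) (trans (sum-cong-≗ (λ u → cong 𝟙 (pointwise u))) (sum-δ₁ v))
  where
  open IsCycleCover cover
  pointwise : ∀ u → leaves ⁅ v ⁆ s u ≡ does (u Fin.≟ v)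
  pointwise u rewrite lookup-⁅⁆ v u | lookup-⁅⁆ v (s u) with u Fin.≟ v
  ... | no _     = refl
  ... | yes refl rewrite dec-false (s u Fin.≟ u) (no-loop u) = refl

-- The only arc that can enter `v` is the one from `pred v`, and `no-loop` places its tail outside
-- `⁅ v ⁆`.
degIn≡1 : ∀ {ν} {s : Fin ν → Fin ν} → IsCycleCover s → ∀ v → value (δin ν ⁅ v ⁆) s ≡ 1ℚ
degIn≡1 {s = s} cover v = trans (value-δin ⁅ v ⁆ s) (trans (sum-cong-≗ (λ u → cong 𝟙 (pointwise u))) (sum-δ₁ (pred v)))
  where
  open IsCycleCover cover
  pointwise : ∀ u → enters ⁅ v ⁆ s u ≡ does (u Fin.≟ pred v)
  pointwise u rewrite lookup-⁅⁆ v u | lookup-⁅⁆ v (s u) with s u Fin.≟ v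
  ... | yes refl rewrite dec-true (u Fin.≟ pred (s u)) (sym (pred∘s u))
                       | dec-false (u Fin.≟ s u) (no-loop u ∘ sym) = refl
  ... | no su≢v  rewrite dec-false (u Fin.≟ pred v) (λ e → su≢v (trans (cong s e) (s∘pred v))) =
    BoolP.∧-zeroʳ (not (does (u Fin.≟ v)))

unitV-does : ∀ {n} (i j : Fin n) → unitV i j ≡ 𝟙 (does (i Fin.≟ j))
unitV-does i j with i Fin.≟ j
... | yes _ = refl
... | no  _ = refl

value-negV : ∀ {ν} (a : Fin (ν ℕ.* ν) → ℚ) (s : Fin ν → Fin ν) → value (negV a) s ≡ - value a s
value-negV a s = sum-neg (λ u → a (combine u (s u)))

value-unitV : ∀ {ν} (i : Fin (ν ℕ.* ν)) (s : Fin ν → Fin ν) → value (unitV i) s ≡ ι (count (λ u → does (i Fin.≟ combine u (s u))))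
value-unitV i s = trans (sum-cong-≗ (λ u → unitV-does i (combine u (s u)))) (sum-𝟙 (λ u → does (i Fin.≟ combine u (s u))))

-- The index `i` determines its tail, so only the vertex `tailV ν i` can contribute.
value-unitV≤1 : ∀ {ν} (i : Fin (ν ℕ.* ν)) (s : Fin ν → Fin ν) → value (unitV i) s ≤ 1ℚ
value-unitV≤1 {ν} i s = ℚP.≤-trans (sum-mono pointwise) (ℚP.≤-reflexive (sum-δ₁ (tailV ν i)))
  where
  pointwise : ∀ u → unitV i (combine u (s u)) ≤ 𝟙 (does (u Fin.≟ tailV ν i))
  pointwise u with i Fin.≟ combine u (s u)
  ... | no _     = 𝟙-nonneg (does (u Fin.≟ tailV ν i))
  ... | yes refl rewrite dec-true (u Fin.≟ tailV ν i) (sym (cong proj₁ (FinP.remQuot-combine u (s u)))) = ℚP.≤-refl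

unitV-nonneg : ∀ {n} (i j : Fin n) → 0ℚ ≤ unitV i j
unitV-nonneg i j = subst (0ℚ ≤_) (sym (unitV-does i j)) (𝟙-nonneg (does (i Fin.≟ j)))

δout-nonneg : ∀ {ν} (U : Subset ν) i → 0ℚ ≤ δout ν U i
δout-nonneg {ν} U i = subst (0ℚ ≤_) (sym (if-𝟙 _)) (𝟙-nonneg (lookup U (tailV ν i) ∧ not (lookup U (headV ν i))))

δin-nonneg : ∀ {ν} (U : Subset ν) i → 0ℚ ≤ δin ν U i
δin-nonneg {ν} U i = subst (0ℚ ≤_) (sym (if-𝟙 _)) (𝟙-nonneg (not (lookup U (tailV ν i)) ∧ lookup U (headV ν i)))

module _ {ν n t : ℕ} (t+2≤n : 2 ℕ.+ t ℕ.≤ n) (σ ρ : Fin ν → Fin ν) (τ : Fin ν → Fin n) where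

  open Extrapolation t+2≤n σ ρ τ

  module _ (cover : ∀ w → IsCycleCover (world w)) (conn : ∀ g → IsConnected (world (suc g))) where

    -- For nonnegative coefficients, dropping the `ρ` terms and adding the unselected vertices can
    -- only increase the sum.
    gain≤value : ∀ {a} → (∀ i → 0ℚ ≤ a i) → (k : Fin n → Bool) →
      sum (λ u → 𝟙 (k (τ u)) * (a (combine u (σ u)) - a (combine u (ρ u)))) ≤ value a σ
    gain≤value {a} nonneg k = sum-mono λ u →
      𝟙-*-≤ (k (τ u)) (p-q≤p (nonneg (combine u (ρ u)))) (nonneg (combine u (σ u)))

    -- Serves the degree equations: every world, C included, satisfies them exactly, so all slacks
    -- vanish in both inequalities.
    tight : ∀ {a b} → (∀ w → value a (world w) ≡ b) → LocallyValid a b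
    tight {a} {b} eq = (λ g → ℚP.≤-reflexive (sym (zero-slack (suc g)))) , inj₁ (ℚP.≤-reflexive (zero-slack zero))
      where
      zero-slack : ∀ w → slack a b w ≡ 0ℚ
      zero-slack w = trans (cong (_- b) (eq w)) (ℚP.+-inverseʳ b)

    -- The slack of σ is m - 1 for a cut crossed m times, and m ≤ 2 (m - 1) as soon as m ≥ 2.
    cut : ∀ {a} → (∀ i → 0ℚ ≤ a i) → (c : Fin (suc n) → ℕ) → (∀ w → value a (world w) ≡ ι (c w)) →
      (∀ g → c (suc g) ≢ 0) → LocallyValid a 1ℚ
    cut {a} nonneg c eq c≢0 = (λ g → p≤q⇒0≤q-p (subst (1ℚ ≤_) (sym (eq (suc g))) (ι-mono (ℕP.n≢0⇒n>0 (c≢0 g))))) , base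
      where
      slack≡ : ∀ {k} → c zero ≡ k → slack a 1ℚ zero ≡ ι k - 1ℚ
      slack≡ e = cong (_- 1ℚ) (trans (eq zero) (cong ι e))
      base : slack a 1ℚ zero ≤ 0ℚ ⊎ (0ℚ ≤ slack a 1ℚ zero × (∀ (k : Fin n → Bool) →
        sum (λ u → 𝟙 (k (τ u)) * (a (combine u (σ u)) - a (combine u (ρ u)))) ≤ slack a 1ℚ zero + slack a 1ℚ zero))
      base with c zero in e
      -- C is disconnected and may miss the cut. Its slack is then -1, which the nonpositive case
      -- admits.
      ... | 0 = inj₁ (subst (_≤ 0ℚ) (sym (slack≡ e)) (ℚP.≤ᵇ⇒≤ _))
      ... | 1 = inj₁ (subst (_≤ 0ℚ) (sym (slack≡ e)) ℚP.≤-refl)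
      ... | suc (suc m) = inj₂ (subst (0ℚ ≤_) (sym slack≡1+m) (ι-nonneg (suc m)) , λ k →
        ℚP.≤-trans (gain≤value nonneg k) (subst₂ _≤_ (sym (trans (eq zero) (cong ι e)))
          (trans (ι-+ (suc m) (suc m)) (sym (cong₂ _+_ slack≡1+m slack≡1+m)))
          (ι-mono (s≤s (ℕP.m≤n+m (suc m) m)))))
        where
        slack≡1+m : slack a 1ℚ zero ≡ ι (suc m)
        slack≡1+m = trans (slack≡ e) (solve 1 (λ x → con 1ℚ :+ x :- con 1ℚ := x) refl (ι (suc m)))
          where
          open +-*-Solver

    DFJ⇒LocallyValid : ∀ {a b} → DFJ ν a b → LocallyValid a b
    DFJ⇒LocallyValid (cutIn U ne pr) = cut (δin-nonneg U) (λ w → count (enters U (world w)))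
      (λ w → trans (value-δin U (world w)) (sum-𝟙 (enters U (world w)))) (λ g → connected⇒enters (conn g) U ne pr)
    DFJ⇒LocallyValid (cutOut U ne pr) = cut (δout-nonneg U) (λ w → count (leaves U (world w)))
      (λ w → trans (value-δout U (world w)) (sum-𝟙 (leaves U (world w)))) (λ g → connected⇒leaves (conn g) U ne pr)
    DFJ⇒LocallyValid (degIn≥ v)  = tight {δin ν ⁅ v ⁆} (λ w → degIn≡1 (cover w) v)
    DFJ⇒LocallyValid (degIn≤ v)  = tight {negV (δin ν ⁅ v ⁆)} (λ w → trans (value-negV (δin ν ⁅ v ⁆) (world w)) (cong -_ (degIn≡1 (cover w) v)))
    DFJ⇒LocallyValid (degOut≥ v) = tight {δout ν ⁅ v ⁆} (λ w → degOut≡1 (cover w) v)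
    DFJ⇒LocallyValid (degOut≤ v) = tight {negV (δout ν ⁅ v ⁆)} (λ w → trans (value-negV (δout ν ⁅ v ⁆) (world w)) (cong -_ (degOut≡1 (cover w) v)))
    -- With right-hand side 0 the slack of C is its value, so the gain is at most one slack and
    -- hence at most two.
    DFJ⇒LocallyValid (lower i _) = (λ g → nonneg (suc g)) , inj₂ (nonneg zero , λ k →
      ℚP.≤-trans (gain≤value (unitV-nonneg i) k) (subst (_≤ slack (unitV i) 0ℚ zero + slack (unitV i) 0ℚ zero)
        (trans (ℚP.+-identityˡ _) (ℚP.+-identityʳ _)) (ℚP.+-monoˡ-≤ (slack (unitV i) 0ℚ zero) (nonneg zero))))
      where
      nonneg : ∀ w → 0ℚ ≤ slack (unitV i) 0ℚ w
      nonneg w = subst (0ℚ ≤_) (sym (ℚP.+-identityʳ (value (unitV i) (world w))))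
                   (sum-nonneg (λ u → unitV-nonneg i (combine u (world w u))))
    DFJ⇒LocallyValid (upper i _) = (λ g → nonneg (suc g)) , base
      where
      slack≡ : ∀ w → slack (negV (unitV i)) (- 1ℚ) w ≡ 1ℚ - value (unitV i) (world w)
      slack≡ w = trans (cong (_- (- 1ℚ)) (value-negV (unitV i) (world w)))
        (solve 1 (λ x → :- x :- con (- 1ℚ) := con 1ℚ :- x) refl (value (unitV i) (world w)))
        where
        open +-*-Solver
      nonneg : ∀ w → 0ℚ ≤ slack (negV (unitV i)) (- 1ℚ) w
      nonneg w = subst (0ℚ ≤_) (sym (slack≡ w)) (p≤q⇒0≤q-p (value-unitV≤1 i (world w)))
      -- With the sign reversed, slack is lost only through the arcs of `ρ`, and at most one of them
      -- is the edge `i`.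
      gain≤1 : ∀ (k : Fin n → Bool) →
        sum (λ u → 𝟙 (k (τ u)) * (negV (unitV i) (combine u (σ u)) - negV (unitV i) (combine u (ρ u)))) ≤ 1ℚ
      gain≤1 k = ℚP.≤-trans (sum-mono λ u → 𝟙-*-≤ (k (τ u))
        (subst (_≤ unitV i (combine u (ρ u)))
          (solve 2 (λ x z → z :- x := :- x :- :- z) refl (unitV i (combine u (σ u))) (unitV i (combine u (ρ u))))
          (p-q≤p (unitV-nonneg i (combine u (σ u)))))
        (unitV-nonneg i (combine u (ρ u)))) (value-unitV≤1 i ρ)
        where
        open +-*-Solver
      base : slack (negV (unitV i)) (- 1ℚ) zero ≤ 0ℚ ⊎ (0ℚ ≤ slack (negV (unitV i)) (- 1ℚ) zero × (∀ (k : Fin n → Bool) →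
        sum (λ u → 𝟙 (k (τ u)) * (negV (unitV i) (combine u (σ u)) - negV (unitV i) (combine u (ρ u))))
          ≤ slack (negV (unitV i)) (- 1ℚ) zero + slack (negV (unitV i)) (- 1ℚ) zero))
      -- If C uses the edge `i`, its slack is nonpositive; otherwise its slack is 1, and twice that
      -- exceeds the gain, which is at most 1.
      base with count {ν} (λ u → does (i Fin.≟ combine u (σ u))) in e
      ... | suc m = inj₁ (subst (_≤ 0ℚ) (sym (trans (slack≡ zero) (cong (λ x → 1ℚ - x) (trans (value-unitV {ν} i σ) (cong ι e)))))
        (subst (_≤ 0ℚ) (solve 1 (λ x → con 0ℚ :- x := con 1ℚ :- (con 1ℚ :+ x)) refl (ι m)) (p-q≤p (ι-nonneg m))))
        where
        open +-*-Solver
      ... | zero = inj₂ (nonneg zero , λ k → ℚP.≤-trans (gain≤1 k)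
        (subst (1ℚ ≤_) (sym (cong₂ _+_ slack≡1 slack≡1)) (ℚP.≤ᵇ⇒≤ _)))
        where
        slack≡1 : slack (negV (unitV i)) (- 1ℚ) zero ≡ 1ℚ
        slack≡1 = trans (slack≡ zero) (cong (λ x → 1ℚ - x) (trans (value-unitV {ν} i σ) (cong ι e)))

    mix∈SA : InSA t ν mix
    mix∈SA = mix-⊥ , λ a b c S Q _ _ _ small → LocallyValid⇒SA {a} {b} (DFJ⇒LocallyValid c) S Q small

-- Walks and metric completions

Unique⇒lookup-injective : {A : Set} {xs : List A} → Unique xs →
  ∀ i j → List.lookup xs i ≡ List.lookup xs j → i ≡ j
Unique⇒lookup-injective (x∉ ∷ u) zero    zero    eq = refl
Unique⇒lookup-injective (x∉ ∷ u) zero    (suc j) eq = contradiction eq (All.lookup x∉ (∈-lookup j))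
Unique⇒lookup-injective (x∉ ∷ u) (suc i) zero    eq = contradiction (sym eq) (All.lookup x∉ (∈-lookup i))
Unique⇒lookup-injective (x∉ ∷ u) (suc i) (suc j) eq = cong suc (Unique⇒lookup-injective u i j eq)

Unique⇒length≤ : ∀ {n} {xs : List (Fin n)} → Unique xs → length xs ℕ.≤ n
Unique⇒length≤ u = FinP.injective⇒≤ (λ {i} {j} → Unique⇒lookup-injective u i j)

-- A finite search space for shortest dipaths: a list over `Fin n` without repetitions has length at
-- most n.
listsUpTo : ∀ {n} → ℕ → List (List (Fin n))
listsUpTo zero        = [] ∷ []
listsUpTo {n} (suc k) = [] ∷ cartesianProductWith _∷_ (allFin n) (listsUpTo k)

∈-listsUpTo : ∀ {n} (xs : List (Fin n)) {k} → length xs ℕ.≤ k → xs ∈ listsUpTo k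
∈-listsUpTo []       {zero}  h       = here refl
∈-listsUpTo []       {suc k} h       = here refl
∈-listsUpTo (x ∷ xs) {suc k} (s≤s h) = there (∈-cartesianProductWith⁺ _∷_ (∈-allFin x) (∈-listsUpTo xs h))

module Digraph {ν : ℕ} (E : Fin ν → Fin ν → Bool) where

  Arc : Fin ν → Fin ν → Set
  Arc u v = E u v ≡ true

  consec? : ∀ p → Dec (Consec Arc p)
  consec? []          = yes tt
  consec? (x ∷ [])    = yes tt
  consec? (x ∷ y ∷ p) = (E x y BoolP.≟ true) ×-dec consec? (y ∷ p)

  dipath? : ∀ v w p → Dec (IsDipath E v w p)
  dipath? v w p = AllPairs.allPairs? (λ x y → ¬? (x Fin.≟ y)) p
    ×-dec MaybeP.≡-dec Fin._≟_ (head p) (just v)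
    ×-dec MaybeP.≡-dec Fin._≟_ (last p) (just w)
    ×-dec consec? p

  suffix : ∀ {w v} p → v ∈ p → Unique p → last p ≡ just w → Consec Arc p → ∃ (IsDipath E v w)
  suffix (x ∷ p)     (here refl) u l c = x ∷ p , u , refl , l , c
  suffix (x ∷ y ∷ p) (there v∈)  (_ ∷ u) l (_ , c) = suffix (y ∷ p) v∈ u l c

  -- Loop erasure: if the vertex to be prepended already lies on the path, the path is cut back to
  -- the suffix starting there.
  walk⇒dipath : ∀ {v w} → Star Arc v w → ∃ (IsDipath E v w)
  walk⇒dipath {v} Star.ε = v ∷ [] , All.[] ∷ [] , refl , refl , tt
  walk⇒dipath {v} (e ◅ es) with walk⇒dipath es
  ... | x ∷ p , u , refl , l , c with _∈?_ Fin._≟_ v (x ∷ p)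
  ...   | yes v∈p = suffix (x ∷ p) v∈p u l c
  ...   | no v∉p  = v ∷ x ∷ p , AllP.¬Any⇒All¬ (x ∷ p) v∉p ∷ u , refl , l , e , c

  total : (Fin ν → Fin ν → ℕ) → ∀ {u v} → Star Arc u v → ℕ
  total φ Star.ε                    = 0
  total φ (_◅_ {u} {v} e es)   = φ u v ℕ.+ total φ es

  Visited : ∀ {u v} → Star Arc u v → Fin ν → Set
  Visited {u} Star.ε        y = y ≡ u
  Visited {u} (e ◅ es) y = y ≡ u ⊎ Visited es y

  visits-start : ∀ {u v} (W : Star Arc u v) → Visited W u
  visits-start Star.ε        = refl
  visits-start (e ◅ es) = inj₁ refl

  visited-◅◅ : ∀ {u v w y} (W : Star Arc u v) (W′ : Star Arc v w) → Visited W′ y → Visited (W ◅◅ W′) y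
  visited-◅◅ Star.ε        W′ h = h
  visited-◅◅ (e ◅ es) W′ h = inj₂ (visited-◅◅ es W′ h)

  total-◅◅ : ∀ φ {u v w} (W : Star Arc u v) (W′ : Star Arc v w) →
             total φ (W ◅◅ W′) ≡ total φ W ℕ.+ total φ W′
  total-◅◅ φ Star.ε        W′ = refl
  total-◅◅ φ (_◅_ {u} {v} e es) W′ = trans (cong (φ u v ℕ.+_) (total-◅◅ φ es W′)) (sym (ℕP.+-assoc (φ u v) _ _))

  total-mono : ∀ {φ ψ : Fin ν → Fin ν → ℕ} → (∀ u v → Arc u v → φ u v ℕ.≤ ψ u v) →
               ∀ {u v} (W : Star Arc u v) → total φ W ℕ.≤ total ψ W
  total-mono h Star.ε        = z≤n
  total-mono h (e ◅ es) = ℕP.+-mono-≤ (h _ _ e) (total-mono h es)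

  total-+ : ∀ φ ψ {u v} (W : Star Arc u v) → total (λ u v → φ u v ℕ.+ ψ u v) W ≡ total φ W ℕ.+ total ψ W
  total-+ φ ψ Star.ε        = refl
  total-+ φ ψ (_◅_ {u} {v} e es) rewrite total-+ φ ψ es = interchange (φ u v) (ψ u v) (total φ es) (total ψ es)
    where
    interchange : ∀ a b c d → (a ℕ.+ b) ℕ.+ (c ℕ.+ d) ≡ (a ℕ.+ c) ℕ.+ (b ℕ.+ d)
    interchange = ℕRing.solve-∀

  total-sum : ∀ {n} (φ : Fin n → Fin ν → Fin ν → ℕ) {u v} (W : Star Arc u v) →
              total (λ u v → sumℕ (λ g → φ g u v)) W ≡ sumℕ (λ g → total (φ g) W)
  total-sum {zero}  φ Star.ε        = refl
  total-sum {zero}  φ (e ◅ es) = total-sum φ es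
  total-sum {suc n} φ W = trans (total-+ (φ zero) (λ u v → sumℕ (λ g → φ (suc g) u v)) W)
    (cong (total (φ zero) W ℕ.+_) (total-sum (φ ∘ suc) W))

  entering leaving : (Fin ν → Bool) → Fin ν → Fin ν → ℕ
  entering P u v = 𝟙ℕ (not (P u) ∧ P v)
  leaving  P u v = 𝟙ℕ (P u ∧ not (P v))

  -- Along a walk, departures from `P` minus arrivals telescope to a difference of the two ends. The
  -- identity is written additively to avoid subtraction in ℕ.
  balance : ∀ P {u v} (W : Star Arc u v) →
            total (leaving P) W ℕ.+ 𝟙ℕ (P v) ≡ total (entering P) W ℕ.+ 𝟙ℕ (P u)
  balance P Star.ε = refl
  balance P {v = w} (_◅_ {u} {v} e es) = begin
    (leaving P u v ℕ.+ total (leaving P) es) ℕ.+ 𝟙ℕ (P w)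
      ≡⟨ ℕP.+-assoc (leaving P u v) _ _ ⟩
    leaving P u v ℕ.+ (total (leaving P) es ℕ.+ 𝟙ℕ (P w))
      ≡⟨ cong (leaving P u v ℕ.+_) (balance P es) ⟩
    leaving P u v ℕ.+ (total (entering P) es ℕ.+ 𝟙ℕ (P v))
      ≡⟨ swap (leaving P u v) _ _ ⟩
    (leaving P u v ℕ.+ 𝟙ℕ (P v)) ℕ.+ total (entering P) es
      ≡⟨ cong (ℕ._+ total (entering P) es) (step (P u) (P v)) ⟩
    (entering P u v ℕ.+ 𝟙ℕ (P u)) ℕ.+ total (entering P) es
      ≡⟨ swap′ (entering P u v) _ _ ⟩
    (entering P u v ℕ.+ total (entering P) es) ℕ.+ 𝟙ℕ (P u) ∎
    where
    open ≡-Reasoning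
    swap : ∀ a b c → a ℕ.+ (b ℕ.+ c) ≡ (a ℕ.+ c) ℕ.+ b
    swap = ℕRing.solve-∀
    swap′ : ∀ a b c → (a ℕ.+ b) ℕ.+ c ≡ (a ℕ.+ c) ℕ.+ b
    swap′ = ℕRing.solve-∀
    step : ∀ p q → 𝟙ℕ (p ∧ not q) ℕ.+ 𝟙ℕ q ≡ 𝟙ℕ (not p ∧ q) ℕ.+ 𝟙ℕ p
    step true  true  = refl
    step true  false = refl
    step false true  = refl
    step false false = refl

  closed-balance : ∀ P {u} (W : Star Arc u u) → total (leaving P) W ≡ total (entering P) W
  closed-balance P {u} W = ℕP.+-cancelʳ-≡ (𝟙ℕ (P u)) _ _ (balance P W)

  uncrossed⇒constant : ∀ P {u v y} (W : Star Arc u v) → total (leaving P) W ≡ 0 → total (entering P) W ≡ 0 →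
                       Visited W y → P y ≡ P u
  uncrossed⇒constant P Star.ε        _ _ refl        = refl
  uncrossed⇒constant P (e ◅ es) _ _ (inj₁ refl) = refl
  uncrossed⇒constant P (_◅_ {u} {v} e es) l≡0 e≡0 (inj₂ y∈) = trans
    (uncrossed⇒constant P es (ℕP.m+n≡0⇒n≡0 (leaving P u v) l≡0) (ℕP.m+n≡0⇒n≡0 (entering P u v) e≡0) y∈)
    (step (P u) (P v) (ℕP.m+n≡0⇒m≡0 _ l≡0) (ℕP.m+n≡0⇒m≡0 _ e≡0))
    where
    step : ∀ p q → 𝟙ℕ (p ∧ not q) ≡ 0 → 𝟙ℕ (not p ∧ q) ≡ 0 → q ≡ p
    step true  true  _ _ = refl
    step false false _ _ = refl

  -- On a closed walk arrivals equal departures. If there were none, `P` would be constant along the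
  -- walk, yet it separates two visited vertices.
  closed-walk-enters : ∀ P {u} (W : Star Arc u u) {y z} → Visited W y → Visited W z →
    P y ≡ true → P z ≡ false → 1 ℕ.≤ total (entering P) W
  closed-walk-enters P W y∈ z∈ Py Pz = ℕP.n≢0⇒n>0 λ e≡0 →
    let l≡0 = trans (closed-balance P W) e≡0 in
    contradiction (trans (sym Py) (trans (uncrossed⇒constant P W l≡0 e≡0 y∈)
      (trans (sym (uncrossed⇒constant P W l≡0 e≡0 z∈)) Pz))) λ ()

  module Completion (c : Fin ν → Fin ν → ℕ) (strong : ∀ v w → Star Arc v w) where

    costℕ : (Fin ν → Fin ν → ℕ) → List (Fin ν) → ℕ
    costℕ f []          = 0
    costℕ f (x ∷ [])    = 0
    costℕ f (x ∷ y ∷ p) = f x y ℕ.+ costℕ f (y ∷ p)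

    pathCost-ι : ∀ f p → pathCost (λ u v → ι (f u v)) p ≡ ι (costℕ f p)
    pathCost-ι f []          = refl
    pathCost-ι f (x ∷ [])    = refl
    pathCost-ι f (x ∷ y ∷ p) = trans (+-congˡ (ι (f x y)) (pathCost-ι f (y ∷ p)))
                                     (sym (ι-+ (f x y) (costℕ f (y ∷ p))))

    dipath : ∀ v w → ∃ (IsDipath E v w)
    dipath v w = walk⇒dipath (strong v w)

    -- The default argument of `argmin` is itself a dipath, supplied by strong connectivity, so the
    -- minimiser is always a dipath.
    shortest : Fin ν → Fin ν → List (Fin ν)
    shortest v w = argmin (costℕ c) (proj₁ (dipath v w)) (filter (dipath? v w) (listsUpTo ν))

    shortest-isDipath : ∀ v w → IsDipath E v w (shortest v w)
    shortest-isDipath v w = argmin-all (costℕ c) (proj₂ (dipath v w)) (AllP.all-filter (dipath? v w) (listsUpTo ν))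

    dist : Fin ν → Fin ν → ℕ
    dist v w = costℕ c (shortest v w)

    dist≤cost : ∀ {v w} p → IsDipath E v w p → dist v w ℕ.≤ costℕ c p
    dist≤cost {v} {w} p p-path = f[argmin]≤v⁺ (proj₁ (dipath v w)) _
      (inj₂ (lose (∈-filter⁺ (dipath? v w) (∈-listsUpTo p (Unique⇒length≤ (proj₁ p-path))) p-path) ℕP.≤-refl))

    dist-isMetricCompletion : IsMetricCompletion E (λ u v → ι (c u v)) (λ u v → ι (dist u v))
    dist-isMetricCompletion v w _ =
      (shortest v w , shortest-isDipath v w , pathCost-ι c (shortest v w)) ,
      λ p p-path → subst (ι (dist v w) ≤_) (sym (pathCost-ι c p)) (ι-mono (dist≤cost p p-path))

    dist≤c : ∀ {v w} → v ≢ w → Arc v w → dist v w ℕ.≤ c v w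
    dist≤c {v} {w} v≢w e = subst (dist v w ℕ.≤_) (ℕP.+-identityʳ (c v w))
      (dist≤cost (v ∷ w ∷ []) ((v≢w All.∷ All.[]) ∷ All.[] ∷ [] , refl , refl , e , tt))

    dipath⇒walk : ∀ {v w} p → IsDipath E v w p → Σ (Star Arc v w) λ W → total c W ≡ costℕ c p
    dipath⇒walk (x ∷ [])    (_ , refl , refl , _) = Star.ε , refl
    dipath⇒walk (x ∷ y ∷ p) (_ ∷ u , refl , l , e , es) =
      let (W , eq) = dipath⇒walk (y ∷ p) (u , refl , l , es)
      in e ◅ W , cong (c x y ℕ.+_) eq

    -- Replacing each edge of the completion by a shortest dipath gives a walk in G of the same
    -- cost. The target `z` is kept apart from the start so that the induction can move the start; a
    -- tour has `z` equal to `x`.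
    tour⇒walk : ∀ x xs z → Σ (Star Arc x z) λ W →
      total c W ≡ costℕ dist (x ∷ xs ++ z ∷ []) × (∀ y → y ∈ x ∷ xs → Visited W y)
    tour⇒walk x [] z =
      let (W , eq) = dipath⇒walk (shortest x z) (shortest-isDipath x z)
      in W , trans eq (sym (ℕP.+-identityʳ _)) , λ { _ (here refl) → visits-start W }
    tour⇒walk x (x′ ∷ xs) z =
      let (W , eq)        = dipath⇒walk (shortest x x′) (shortest-isDipath x x′)
          (W′ , eq′ , vis) = tour⇒walk x′ xs z
      in W ◅◅ W′ , trans (total-◅◅ c W W′) (cong₂ ℕ._+_ eq eq′) ,
         λ { _ (here refl) → visits-start (W ◅◅ W′) ; y (there y∈) → visited-◅◅ W W′ (vis y y∈) }

-- Lower bound on tours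

-- Gap `g` separates positions g and g + 1, and a step from `p` to `q` crosses only the gaps between
-- them. The induction removes the lowest gap; when both positions are positive they are not
-- separated by it and shift down together.
crossings-≤ : ∀ n p q → sumℕ {n} (λ g → 𝟙ℕ ((p <ᵇ suc (toℕ g)) ∧ not (q <ᵇ suc (toℕ g)))
                               ℕ.+ 𝟙ℕ (not (p <ᵇ suc (toℕ g)) ∧ (q <ᵇ suc (toℕ g)))) ℕ.≤ ℕ.∣ p - q ∣
crossings-≤ zero    p       q       = z≤n
crossings-≤ (suc n) zero    zero    = crossings-≤ n zero zero
crossings-≤ (suc n) zero    (suc q) = s≤s (crossings-≤ n zero q)
crossings-≤ (suc n) (suc p) zero    = s≤s (ℕP.≤-trans (crossings-≤ n p zero) (ℕP.≤-reflexive (ℕP.∣-∣-identityʳ p)))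
crossings-≤ (suc n) (suc p) (suc q) = crossings-≤ n p q

-- At most one term equals 1. Once it occurs as the head, the pair condition makes every later term
-- at least 2; a larger head leaves the bound to the tail.
sum-lower-bound : ∀ {n} (f : Fin n → ℕ) → (∀ i → 1 ℕ.≤ f i) → (∀ i j → i Fin.< j → 3 ℕ.≤ f i ℕ.+ f j) →
                  2 ℕ.* n ℕ.≤ suc (sumℕ f)
sum-lower-bound {zero}  f _   _    = z≤n
sum-lower-bound {suc n} f pos pair with f zero in eq | pos zero
... | suc (suc k) | _ = begin
  2 ℕ.* suc n                  ≡⟨ ℕP.*-suc 2 n ⟩
  2 ℕ.+ 2 ℕ.* n                ≤⟨ ℕP.+-monoʳ-≤ 2 (sum-lower-bound (f ∘ suc) (pos ∘ suc) (λ i j i<j → pair (suc i) (suc j) (s≤s i<j))) ⟩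
  3 ℕ.+ sumℕ (f ∘ suc)         ≤⟨ ℕP.+-monoʳ-≤ 3 (ℕP.m≤n+m _ k) ⟩
  3 ℕ.+ (k ℕ.+ sumℕ (f ∘ suc)) ∎
  where
  open ℕP.≤-Reasoning
... | suc zero | _ = begin
  2 ℕ.* suc n              ≡⟨ ℕP.*-suc 2 n ⟩
  2 ℕ.+ 2 ℕ.* n            ≤⟨ ℕP.+-monoʳ-≤ 2 (twos (f ∘ suc) λ j → ℕP.≤-pred (subst (λ k → 3 ℕ.≤ k ℕ.+ f (suc j)) eq (pair zero (suc j) (s≤s z≤n)))) ⟩
  2 ℕ.+ sumℕ (f ∘ suc)     ∎
  where
  open ℕP.≤-Reasoning
  twos : ∀ {n} (f : Fin n → ℕ) → (∀ i → 2 ℕ.≤ f i) → 2 ℕ.* n ℕ.≤ sumℕ f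
  twos {zero}  f h = z≤n
  twos {suc n} f h = subst (ℕ._≤ sumℕ f) (sym (ℕP.*-suc 2 n)) (ℕP.+-mono-≤ (h zero) (twos (f ∘ suc) (h ∘ suc)))

-- `into-a₀` and `into-bₙ` force every entry into an extreme vertex to cross all n gaps. `at` makes
-- each block of positions nonempty.
module LineBound {ν n : ℕ} (E : Fin ν → Fin ν → Bool) (pos : Fin ν → ℕ)
  (a₀ bₙ : Fin ν) (pos-a₀ : pos a₀ ≡ 0) (pos-bₙ : pos bₙ ≡ n)
  (into-a₀ : ∀ u → E u a₀ ≡ true → pos u ≡ n) (into-bₙ : ∀ u → E u bₙ ≡ true → pos u ≡ 0)
  (at : ∀ k → k ℕ.≤ n → Σ (Fin ν) λ v → pos v ≡ k) where

  open Digraph E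

  left : ℕ → Fin ν → Bool
  left g v = pos v <ᵇ suc g

  between : ℕ → ℕ → Fin ν → Bool
  between g h v = not (left g v) ∧ left h v

  is : Fin ν → Fin ν → Bool
  is w v = does (v Fin.≟ w)

  left-true : ∀ {g v} → pos v ℕ.≤ g → left g v ≡ true
  left-true {g} {v} h = dec-true (pos v ℕP.<? suc g) (s≤s h)

  left-false : ∀ {g v} → g ℕ.< pos v → left g v ≡ false
  left-false {g} {v} h = dec-false (pos v ℕP.<? suc g) (λ { (s≤s p≤g) → ℕP.<⇒≱ h p≤g })

  -- A, B: u, v left of gap g;  C, D: u, v left of gap h;  Ua, Va: u, v equal to a₀;  Ub, Vb: u, v equal to bₙ.
  BlockInequality : (A B C D Ua Va Ub Vb : Bool) → Set
  BlockInequality A B C D Ua Va Ub Vb =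
    𝟙ℕ (not (not A ∧ C) ∧ (not B ∧ D)) ℕ.+ (𝟙ℕ (not Ua ∧ Va) ℕ.+ 𝟙ℕ (not Ub ∧ Vb))
      ℕ.≤ 𝟙ℕ (A ∧ not B) ℕ.+ 𝟙ℕ (not C ∧ D)

  -- An arc into a₀ is paid for by its leftward crossing of gap h. Its head lies left of gap g, so
  -- it does not also enter the block.
  block-a₀ : ∀ A {B C D} Ua {Va} Ub {Vb} → B ≡ true → C ≡ false → D ≡ true → Va ≡ true → Vb ≡ false →
    BlockInequality A B C D Ua Va Ub Vb
  block-a₀ true  true  true  refl refl refl refl refl = z≤n
  block-a₀ true  true  false refl refl refl refl refl = z≤n
  block-a₀ true  false true  refl refl refl refl refl = s≤s z≤n
  block-a₀ true  false false refl refl refl refl refl = s≤s z≤n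
  block-a₀ false true  true  refl refl refl refl refl = z≤n
  block-a₀ false true  false refl refl refl refl refl = z≤n
  block-a₀ false false true  refl refl refl refl refl = s≤s z≤n
  block-a₀ false false false refl refl refl refl refl = s≤s z≤n

  -- Symmetrically, an arc into bₙ is paid for by its rightward crossing of gap g, and its head lies
  -- beyond the block.
  block-bₙ : ∀ {A B} C {D} Ua {Va} Ub {Vb} → A ≡ true → B ≡ false → D ≡ false → Va ≡ false → Vb ≡ true →
    BlockInequality A B C D Ua Va Ub Vb
  block-bₙ true  true  true  refl refl refl refl refl = z≤n
  block-bₙ true  true  false refl refl refl refl refl = s≤s z≤n
  block-bₙ true  false true  refl refl refl refl refl = z≤n
  block-bₙ true  false false refl refl refl refl refl = s≤s z≤n
  block-bₙ false true  true  refl refl refl refl refl = z≤n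
  block-bₙ false true  false refl refl refl refl refl = s≤s z≤n
  block-bₙ false false true  refl refl refl refl refl = z≤n
  block-bₙ false false false refl refl refl refl refl = s≤s z≤n

  -- The block can be entered only from the left across gap g or from the right across gap h.
  block-inner : ∀ A B C D Ua {Va} Ub {Vb} → Va ≡ false → Vb ≡ false →
    BlockInequality A B C D Ua Va Ub Vb
  block-inner A B C D Ua Ub refl refl
    rewrite BoolP.∧-zeroʳ (not Ua) | BoolP.∧-zeroʳ (not Ub)
          | ℕP.+-identityʳ (𝟙ℕ (not (not A ∧ C) ∧ (not B ∧ D))) = go A B C D
    where
    go : ∀ A B C D → 𝟙ℕ (not (not A ∧ C) ∧ (not B ∧ D)) ℕ.≤ 𝟙ℕ (A ∧ not B) ℕ.+ 𝟙ℕ (not C ∧ D)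
    go true  true  C     D     = z≤n
    go true  false C     true  = s≤s z≤n
    go true  false C     false = z≤n
    go false true  true  D     = z≤n
    go false true  false D     = z≤n
    go false false true  D     = z≤n
    go false false false true  = s≤s z≤n
    go false false false false = z≤n

  is-self : ∀ w → is w w ≡ true
  is-self w = dec-true (w Fin.≟ w) refl

  is-other : ∀ {w v} → v ≢ w → is w v ≡ false
  is-other {w} {v} = dec-false (v Fin.≟ w)

  block-cut : ∀ {g h} → g ℕ.< h → h ℕ.< n → ∀ u v → Arc u v →
    entering (between g h) u v ℕ.+ (entering (is a₀) u v ℕ.+ entering (is bₙ) u v)
      ℕ.≤ leaving (left g) u v ℕ.+ entering (left h) u v
  block-cut {g} {h} g<h h<n u v e with v Fin.≟ a₀ | v Fin.≟ bₙ
  ... | no v≢a₀ | no v≢bₙ  = block-inner (left g u) (left g v) (left h u) (left h v) (is a₀ u) (is bₙ u) refl refl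
  ... | no v≢a₀ | yes refl = block-bₙ (left h u) (is a₀ u) (is bₙ u)
    (left-true {g} {u} (subst (ℕ._≤ g) (sym (into-bₙ u e)) z≤n))
    (left-false {g} {bₙ} (subst (g ℕ.<_) (sym pos-bₙ) (ℕP.<-trans g<h h<n)))
    (left-false {h} {bₙ} (subst (h ℕ.<_) (sym pos-bₙ) h<n)) refl refl
  ... | yes refl | no v≢bₙ = block-a₀ (left g u) (is a₀ u) (is bₙ u)
    (left-true {g} {a₀} (subst (ℕ._≤ g) (sym pos-a₀) z≤n))
    (left-false {h} {u} (subst (h ℕ.<_) (sym (into-a₀ u e)) h<n))
    (left-true {h} {a₀} (subst (ℕ._≤ h) (sym pos-a₀) z≤n)) refl refl
  ... | yes refl | yes a₀≡bₙ = contradiction (trans (sym pos-a₀) (trans (cong pos a₀≡bₙ) pos-bₙ))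
    (ℕP.<⇒≢ (ℕP.≤-<-trans z≤n h<n))

  module _ (c : Fin ν → Fin ν → ℕ) (c≥ : ∀ u v → Arc u v → ℕ.∣ pos u - pos v ∣ ℕ.≤ c u v)
    {x} (W : Star Arc x x) (covers : ∀ y → Visited W y) where

    out : ℕ → ℕ
    out g = total (leaving (left g)) W

    enters≥1 : ∀ P y z → P y ≡ true → P z ≡ false → 1 ℕ.≤ total (entering P) W
    enters≥1 P y z = closed-walk-enters P W (covers y) (covers z)

    left-a₀ : ∀ g → left g a₀ ≡ true
    left-a₀ g = left-true {g} {a₀} (subst (ℕ._≤ g) (sym pos-a₀) z≤n)

    left-bₙ : ∀ {g} → g ℕ.< n → left g bₙ ≡ false
    left-bₙ {g} g<n = left-false {g} {bₙ} (subst (g ℕ.<_) (sym pos-bₙ) g<n)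

    out≥1 : ∀ {g} → g ℕ.< n → 1 ℕ.≤ out g
    out≥1 {g} g<n = subst (1 ℕ.≤_) (sym (closed-balance (left g) W))
      (enters≥1 (left g) a₀ bₙ (left-a₀ g) (left-bₙ g<n))

    a₀≢bₙ : ∀ {g} → g ℕ.< n → a₀ ≢ bₙ
    a₀≢bₙ g<n eq = ℕP.<⇒≢ (ℕP.≤-<-trans z≤n g<n) (trans (sym pos-a₀) (trans (cong pos eq) pos-bₙ))

    -- The block, a₀ and bₙ are each entered at least once. These three entries are charged to
    -- rightward crossings of g and leftward crossings of h; closedness turns the latter into
    -- rightward ones.
    out-pair : ∀ {g h} → g ℕ.< h → h ℕ.< n → 3 ℕ.≤ out g ℕ.+ out h
    out-pair {g} {h} g<h h<n = begin
      1 ℕ.+ (1 ℕ.+ 1)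
        ≤⟨ ℕP.+-mono-≤ block (ℕP.+-mono-≤
             (enters≥1 (is a₀) a₀ bₙ (is-self a₀) (is-other (a₀≢bₙ h<n ∘ sym)))
             (enters≥1 (is bₙ) bₙ a₀ (is-self bₙ) (is-other (a₀≢bₙ h<n)))) ⟩
      total inB W ℕ.+ (total inA W ℕ.+ total inZ W)
        ≡⟨ cong (total inB W ℕ.+_) (total-+ inA inZ W) ⟨
      total inB W ℕ.+ total (λ u v → inA u v ℕ.+ inZ u v) W
        ≡⟨ total-+ inB (λ u v → inA u v ℕ.+ inZ u v) W ⟨
      total (λ u v → inB u v ℕ.+ (inA u v ℕ.+ inZ u v)) W
        ≤⟨ total-mono (block-cut g<h h<n) W ⟩
      total (λ u v → leaving (left g) u v ℕ.+ entering (left h) u v) W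
        ≡⟨ total-+ (leaving (left g)) (entering (left h)) W ⟩
      out g ℕ.+ total (entering (left h)) W
        ≡⟨ cong (out g ℕ.+_) (closed-balance (left h) W) ⟨
      out g ℕ.+ out h ∎
      where
      open ℕP.≤-Reasoning
      inB = entering (between g h)
      inA = entering (is a₀)
      inZ = entering (is bₙ)
      block : 1 ℕ.≤ total inB W
      -- A vertex at position h lies in the block g < pos ≤ h, while a₀ lies outside it.
      block with (y , pos-y) ← at h (ℕP.<⇒≤ h<n) = enters≥1 (between g h) y a₀
        (cong₂ (λ p q → not p ∧ q) (left-false {g} {y} (subst (g ℕ.<_) (sym pos-y) g<h))
                                   (left-true {h} {y} (ℕP.≤-reflexive pos-y)))
        (cong (λ p → not p ∧ left h a₀) (left-a₀ g))

    -- Each arc costs at least the number of gaps it crosses. Summed by gap instead of by arc, gap g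
    -- counts `out g` crossings in each direction.
    cost≥2out : 2 ℕ.* sumℕ {n} (λ g → out (toℕ g)) ℕ.≤ total c W
    cost≥2out = begin
      2 ℕ.* sumℕ {n} (λ g → out (toℕ g))
        ≡⟨ cong (sumℕ {n} (λ g → out (toℕ g)) ℕ.+_) (ℕP.+-identityʳ _) ⟩
      sumℕ {n} (λ g → out (toℕ g)) ℕ.+ sumℕ {n} (λ g → out (toℕ g))
        ≡⟨ ∑ℕ-distrib-+ {n} (λ g → out (toℕ g)) (λ g → out (toℕ g)) ⟨
      sumℕ {n} (λ g → out (toℕ g) ℕ.+ out (toℕ g))
        ≡⟨ sumℕ-cong {n} (λ g → trans (cong (out (toℕ g) ℕ.+_) (closed-balance (left (toℕ g)) W))
             (sym (total-+ (leaving (left (toℕ g))) (entering (left (toℕ g))) W))) ⟩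
      sumℕ {n} (λ g → total (crossing g) W)
        ≡⟨ total-sum {n} crossing W ⟨
      total (λ u v → sumℕ {n} (λ g → crossing g u v)) W
        ≤⟨ total-mono (λ u v e → ℕP.≤-trans (crossings-≤ n (pos u) (pos v)) (c≥ u v e)) W ⟩
      total c W ∎
      where
      open ℕP.≤-Reasoning
      crossing : Fin n → Fin ν → Fin ν → ℕ
      crossing g u v = leaving (left (toℕ g)) u v ℕ.+ entering (left (toℕ g)) u v

    closed-walk-cost : 4 ℕ.* n ℕ.≤ 2 ℕ.+ total c W
    closed-walk-cost = begin
      4 ℕ.* n
        ≡⟨ ℕP.*-assoc 2 2 n ⟩
      2 ℕ.* (2 ℕ.* n)
        ≤⟨ ℕP.*-monoʳ-≤ 2 (sum-lower-bound (λ g → out (toℕ g)) (λ g → out≥1 (FinP.toℕ<n g))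
             (λ g h g<h → out-pair g<h (FinP.toℕ<n h))) ⟩
      2 ℕ.* suc (sumℕ {n} (λ g → out (toℕ g)))
        ≡⟨ ℕP.*-suc 2 _ ⟩
      2 ℕ.+ 2 ℕ.* sumℕ {n} (λ g → out (toℕ g))
        ≤⟨ ℕP.+-monoʳ-≤ 2 cost≥2out ⟩
      2 ℕ.+ total c W ∎
      where
      open ℕP.≤-Reasoning

-- The ladder digraph

module Ladder (n′ : ℕ) where

  n : ℕ
  n = suc n′

  Rung : Set
  Rung = Fin (suc n)

  -- inj₁ i and inj₂ i are the two ends aᵢ and bᵢ of the i-th rung.
  V : Set
  V = Rung ⊎ Rung

  -- The exceptional vertices are aₙ and b₀. Gap h governs a_h and b_{h+1}, hence the split at the
  -- top on one side and at the bottom on the other.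
  V-cases : (P : V → Set) → (∀ h → P (inj₁ (inject₁ h))) → P (inj₁ (fromℕ n)) →
            P (inj₂ zero) → (∀ h → P (inj₂ (suc h))) → ∀ v → P v
  V-cases P a aₙ b₀ b (inj₁ i) with view i
  ... | ‵fromℕ     = aₙ
  ... | ‵inject₁ h = a h
  V-cases P a aₙ b₀ b (inj₂ zero)    = b₀
  V-cases P a aₙ b₀ b (inj₂ (suc h)) = b h

  straight cross : V → V
  straight (inj₁ i) with view i
  ... | ‵fromℕ     = inj₁ zero
  ... | ‵inject₁ h = inj₁ (suc h)
  straight (inj₂ zero)    = inj₂ (fromℕ n)
  straight (inj₂ (suc h)) = inj₂ (inject₁ h)
  cross (inj₁ i) with view i
  ... | ‵fromℕ     = inj₁ zero
  ... | ‵inject₁ h = inj₂ (inject₁ h)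
  cross (inj₂ zero)    = inj₂ (fromℕ n)
  cross (inj₂ (suc h)) = inj₁ (suc h)

  -- The value at aₙ and b₀ is junk: there straight and cross agree.
  gap : V → Fin n
  gap (inj₁ i) with view i
  ... | ‵fromℕ     = zero
  ... | ‵inject₁ h = h
  gap (inj₂ zero)    = zero
  gap (inj₂ (suc h)) = h

  -- `k` is the set of broken gaps: empty for C, a singleton for H_g.
  step : (Fin n → Bool) → V → V
  step k v = if k (gap v) then cross v else straight v

  if-same : ∀ {A : Set} b {x : A} → (if b then x else x) ≡ x
  if-same true  = refl
  if-same false = refl

  module _ (k : Fin n → Bool) where

    step-a : ∀ h → step k (inj₁ (inject₁ h)) ≡ (if k h then inj₂ (inject₁ h) else inj₁ (suc h))
    step-a h rewrite view-inject₁ h = refl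

    step-aₙ : step k (inj₁ (fromℕ n)) ≡ inj₁ zero
    step-aₙ rewrite view-fromℕ n = if-same (k zero)

    step-b₀ : step k (inj₂ zero) ≡ inj₂ (fromℕ n)
    step-b₀ = if-same (k zero)

    -- The inverse of `step k`. Breaking gap h swaps the heads of the arcs from a_h and b_{h+1}, so
    -- it swaps the predecessors of a_{h+1} and b_h. An arbitrary `k` treats C and every H_g at
    -- once.
    back : V → V
    back (inj₁ zero)    = inj₁ (fromℕ n)
    back (inj₁ (suc h)) = if k h then inj₂ (suc h) else inj₁ (inject₁ h)
    back (inj₂ i) with view i
    ... | ‵fromℕ     = inj₂ zero
    ... | ‵inject₁ h = if k h then inj₁ (inject₁ h) else inj₂ (suc h)

    back-b : ∀ h → back (inj₂ (inject₁ h)) ≡ (if k h then inj₁ (inject₁ h) else inj₂ (suc h))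
    back-b h rewrite view-inject₁ h = refl

    back-bₙ : back (inj₂ (fromℕ n)) ≡ inj₂ zero
    back-bₙ rewrite view-fromℕ n = refl

    step∘back : ∀ v → step k (back v) ≡ v
    step∘back (inj₁ zero)    = step-aₙ
    step∘back (inj₁ (suc h)) with k h in eq
    ... | true  rewrite eq = refl
    ... | false = trans (step-a h) (cong (λ b → if b then inj₂ (inject₁ h) else inj₁ (suc h)) eq)
    step∘back (inj₂ i) with view i
    ... | ‵fromℕ     = step-b₀
    ... | ‵inject₁ h with k h in eq
    ...   | true  = trans (step-a h) (cong (λ b → if b then inj₂ (inject₁ h) else inj₁ (suc h)) eq)
    ...   | false rewrite eq = refl

    back∘step : ∀ v → back (step k v) ≡ v
    back∘step = V-cases (λ v → back (step k v) ≡ v) a aₙ b₀ b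
      where
      a : ∀ h → back (step k (inj₁ (inject₁ h))) ≡ inj₁ (inject₁ h)
      a h rewrite step-a h with k h in eq
      ... | true  = trans (back-b h) (cong (λ b → if b then inj₁ (inject₁ h) else inj₂ (suc h)) eq)
      ... | false rewrite eq = refl
      aₙ : back (step k (inj₁ (fromℕ n))) ≡ inj₁ (fromℕ n)
      aₙ = cong back step-aₙ
      b₀ : back (step k (inj₂ zero)) ≡ inj₂ zero
      b₀ = trans (cong back step-b₀) back-bₙ
      b : ∀ h → back (step k (inj₂ (suc h))) ≡ inj₂ (suc h)
      b h with k h in eq
      ... | true  rewrite eq = refl
      ... | false = trans (back-b h) (cong (λ b → if b then inj₁ (inject₁ h) else inj₂ (suc h)) eq)

    step≢ : ∀ v → step k v ≢ v
    step≢ = V-cases (λ v → step k v ≢ v) a (λ e → inj₁-zero≢ (trans (sym step-aₙ) e))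
      (λ e → inj₂-zero≢ (trans (sym step-b₀) e)) b
      where
      inject₁≢suc : ∀ {m} (h : Fin m) → inject₁ h ≢ suc h
      inject₁≢suc h e = ℕP.m≢1+m+n (toℕ h) {0} (trans (sym (FinP.toℕ-inject₁ h))
        (trans (cong toℕ e) (sym (ℕP.+-identityʳ _))))
      -- The long arcs are not loops because n is a successor.
      inj₁-zero≢ : inj₁ zero ≢ inj₁ (fromℕ n)
      inj₁-zero≢ ()
      inj₂-zero≢ : inj₂ (fromℕ n) ≢ inj₂ zero
      inj₂-zero≢ ()
      a : ∀ h → step k (inj₁ (inject₁ h)) ≢ inj₁ (inject₁ h)
      a h e with k h | trans (sym (step-a h)) e
      ... | true  | ()
      ... | false | e′ = inject₁≢suc h (sym (inj₁-injective e′))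
      b : ∀ h → step k (inj₂ (suc h)) ≢ inj₂ (suc h)
      b h e with k h | e
      ... | true  | ()
      ... | false | e′ = inject₁≢suc h (inj₂-injective e′)

  -- H_g runs a₀ ... a_g, b_g ... b₀, bₙ ... b_{g+1}, a_{g+1} ... aₙ and back to a₀. Its four
  -- monotone stretches avoid gap g and come from `climb` and `descend`; the remaining lemmas
  -- concatenate them.
  module Break (g : Fin n) where

    here? : Fin n → Bool
    here? h = does (g Fin.≟ h)

    Next : V → V → Set
    Next u v = step here? u ≡ v

    next-a : ∀ {h} → h ≢ g → Next (inj₁ (inject₁ h)) (inj₁ (suc h))
    next-a {h} h≢g = trans (step-a here? h) (cong (if_then inj₂ (inject₁ h) else inj₁ (suc h)) (dec-false (g Fin.≟ h) (h≢g ∘ sym)))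

    next-b : ∀ {h} → h ≢ g → Next (inj₂ (suc h)) (inj₂ (inject₁ h))
    next-b {h} h≢g = cong (if_then inj₁ (suc h) else inj₂ (inject₁ h)) (dec-false (g Fin.≟ h) (h≢g ∘ sym))

    next-ag : Next (inj₁ (inject₁ g)) (inj₂ (inject₁ g))
    next-ag = trans (step-a here? g) (cong (if_then inj₂ (inject₁ g) else inj₁ (suc g)) (dec-true (g Fin.≟ g) refl))

    next-bg : Next (inj₂ (suc g)) (inj₁ (suc g))
    next-bg = cong (if_then inj₁ (suc g) else inj₂ (inject₁ g)) (dec-true (g Fin.≟ g) refl)

    Unbroken : ℕ → Rung → Set
    Unbroken i j = ∀ h → i ℕ.≤ toℕ h → toℕ h ℕ.< toℕ j → h ≢ g

    climb : ∀ j i → toℕ i ℕ.≤ toℕ j → Unbroken (toℕ i) j → Star Next (inj₁ i) (inj₁ j)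
    climb = <-weakInduction (λ j → ∀ i → toℕ i ℕ.≤ toℕ j → Unbroken (toℕ i) j → Star Next (inj₁ i) (inj₁ j))
      (λ { zero _ _ → Star.ε }) up
      where
      up : ∀ h → (∀ i → toℕ i ℕ.≤ toℕ (inject₁ h) → Unbroken (toℕ i) (inject₁ h) → Star Next (inj₁ i) (inj₁ (inject₁ h))) →
           ∀ i → toℕ i ℕ.≤ suc (toℕ h) → Unbroken (toℕ i) (suc h) → Star Next (inj₁ i) (inj₁ (suc h))
      up h ih i i≤ unb with i Fin.≟ suc h
      ... | yes refl = Star.ε
      ... | no i≢ = ih i (subst (toℕ i ℕ.≤_) (sym (FinP.toℕ-inject₁ h)) i≤h)
          (λ h′ l u → unb h′ l (ℕP.m<n⇒m<1+n (subst (toℕ h′ ℕ.<_) (FinP.toℕ-inject₁ h) u)))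
          ◅◅ (next-a (unb h i≤h ℕP.≤-refl) ◅ Star.ε)
        where
        i≤h : toℕ i ℕ.≤ toℕ h
        i≤h = ℕP.≤-pred (ℕP.≤∧≢⇒< i≤ (i≢ ∘ FinP.toℕ-injective))

    descend : ∀ j i → toℕ i ℕ.≤ toℕ j → Unbroken (toℕ i) j → Star Next (inj₂ j) (inj₂ i)
    descend = <-weakInduction (λ j → ∀ i → toℕ i ℕ.≤ toℕ j → Unbroken (toℕ i) j → Star Next (inj₂ j) (inj₂ i))
      (λ { zero _ _ → Star.ε }) up
      where
      up : ∀ h → (∀ i → toℕ i ℕ.≤ toℕ (inject₁ h) → Unbroken (toℕ i) (inject₁ h) → Star Next (inj₂ (inject₁ h)) (inj₂ i)) →
           ∀ i → toℕ i ℕ.≤ suc (toℕ h) → Unbroken (toℕ i) (suc h) → Star Next (inj₂ (suc h)) (inj₂ i)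
      up h ih i i≤ unb with i Fin.≟ suc h
      ... | yes refl = Star.ε
      ... | no i≢ = next-b (unb h i≤h ℕP.≤-refl) ◅ ih i (subst (toℕ i ℕ.≤_) (sym (FinP.toℕ-inject₁ h)) i≤h)
          (λ h′ l u → unb h′ l (ℕP.m<n⇒m<1+n (subst (toℕ h′ ℕ.<_) (FinP.toℕ-inject₁ h) u)))
        where
        i≤h : toℕ i ℕ.≤ toℕ h
        i≤h = ℕP.≤-pred (ℕP.≤∧≢⇒< i≤ (i≢ ∘ FinP.toℕ-injective))

    before : ∀ {i} j → toℕ j ℕ.≤ toℕ g → Unbroken i j
    before j j≤g h _ h<j refl = ℕP.<⇒≱ h<j j≤g

    after : ∀ {i} j → toℕ g ℕ.< i → Unbroken i j
    after j g<i h i≤h _ refl = ℕP.<⇒≱ g<i i≤h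

    toℕ-g : toℕ (inject₁ g) ≡ toℕ g
    toℕ-g = FinP.toℕ-inject₁ g

    ≤top : ∀ (i : Rung) → toℕ i ℕ.≤ toℕ (fromℕ n)
    ≤top = FinP.≤fromℕ

    a₀⇝aᵢ : ∀ i → toℕ i ℕ.≤ toℕ g → Star Next (inj₁ zero) (inj₁ i)
    a₀⇝aᵢ i i≤g = climb i zero z≤n (before i i≤g)

    bg⇝bᵢ : ∀ i → toℕ i ℕ.≤ toℕ g → Star Next (inj₂ (inject₁ g)) (inj₂ i)
    bg⇝bᵢ i i≤g = descend (inject₁ g) i (subst (toℕ i ℕ.≤_) (sym toℕ-g) i≤g) (before (inject₁ g) (ℕP.≤-reflexive toℕ-g))

    bₙ⇝bᵢ : ∀ i → toℕ g ℕ.< toℕ i → Star Next (inj₂ (fromℕ n)) (inj₂ i)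
    bₙ⇝bᵢ i g<i = descend (fromℕ n) i (≤top i) (after (fromℕ n) g<i)

    ag+⇝aᵢ : ∀ i → toℕ g ℕ.< toℕ i → Star Next (inj₁ (suc g)) (inj₁ i)
    ag+⇝aᵢ i g<i = climb i (suc g) g<i (after i ℕP.≤-refl)

    a₀⇝bg : Star Next (inj₁ zero) (inj₂ (inject₁ g))
    a₀⇝bg = a₀⇝aᵢ (inject₁ g) (ℕP.≤-reflexive toℕ-g) ◅◅ (next-ag ◅ Star.ε)

    bg⇝bₙ : Star Next (inj₂ (inject₁ g)) (inj₂ (fromℕ n))
    bg⇝bₙ = bg⇝bᵢ zero z≤n ◅◅ (step-b₀ here? ◅ Star.ε)

    bₙ⇝ag+ : Star Next (inj₂ (fromℕ n)) (inj₁ (suc g))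
    bₙ⇝ag+ = bₙ⇝bᵢ (suc g) ℕP.≤-refl ◅◅ (next-bg ◅ Star.ε)

    from-a₀ : ∀ v → Star Next (inj₁ zero) v
    from-a₀ (inj₁ i) with toℕ i ℕP.≤? toℕ g
    ... | yes i≤g = a₀⇝aᵢ i i≤g
    ... | no i≰g  = a₀⇝bg ◅◅ bg⇝bₙ ◅◅ bₙ⇝ag+ ◅◅ ag+⇝aᵢ i (ℕP.≰⇒> i≰g)
    from-a₀ (inj₂ i) with toℕ i ℕP.≤? toℕ g
    ... | yes i≤g = a₀⇝bg ◅◅ bg⇝bᵢ i i≤g
    ... | no i≰g  = a₀⇝bg ◅◅ bg⇝bₙ ◅◅ bₙ⇝bᵢ i (ℕP.≰⇒> i≰g)

    aᵢ⇝a₀ : ∀ i → toℕ g ℕ.< toℕ i → Star Next (inj₁ i) (inj₁ zero)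
    aᵢ⇝a₀ i g<i = climb (fromℕ n) i (≤top i) (after (fromℕ n) g<i) ◅◅ (step-aₙ here? ◅ Star.ε)

    bₙ⇝a₀ : Star Next (inj₂ (fromℕ n)) (inj₁ zero)
    bₙ⇝a₀ = bₙ⇝ag+ ◅◅ aᵢ⇝a₀ (suc g) ℕP.≤-refl

    to-a₀ : ∀ v → Star Next v (inj₁ zero)
    to-a₀ (inj₁ i) with toℕ i ℕP.≤? toℕ g
    ... | no i≰g  = aᵢ⇝a₀ i (ℕP.≰⇒> i≰g)
    ... | yes i≤g = climb (inject₁ g) i (subst (toℕ i ℕ.≤_) (sym toℕ-g) i≤g) (before (inject₁ g) (ℕP.≤-reflexive toℕ-g))
                    ◅◅ next-ag ◅ bg⇝bₙ ◅◅ bₙ⇝a₀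
    to-a₀ (inj₂ i) with toℕ i ℕP.≤? toℕ g
    ... | yes i≤g = descend i zero z≤n (before i i≤g) ◅◅ step-b₀ here? ◅ bₙ⇝a₀
    ... | no i≰g  = descend i (suc g) (ℕP.≰⇒> i≰g) (after i ℕP.≤-refl) ◅◅ next-bg ◅ aᵢ⇝a₀ (suc g) ℕP.≤-refl

    everywhere : ∀ u v → Star Next u v
    everywhere u v = to-a₀ u ◅◅ from-a₀ v

  -- The ladder as a digraph on `Fin ν`

  ν : ℕ
  ν = suc n ℕ.+ suc n

  dec : Fin ν → V
  dec = splitAt (suc n)

  enc : V → Fin ν
  enc = join (suc n) (suc n)

  dec∘enc : ∀ v → dec (enc v) ≡ v
  dec∘enc = FinP.splitAt-join (suc n) (suc n)

  enc∘dec : ∀ u → enc (dec u) ≡ u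
  enc∘dec = FinP.join-splitAt (suc n) (suc n)

  σ ρ : Fin ν → Fin ν
  σ u = enc (straight (dec u))
  ρ u = enc (cross (dec u))

  τ : Fin ν → Fin n
  τ u = gap (dec u)

  stepF : (Fin n → Bool) → Fin ν → Fin ν
  stepF k u = if k (τ u) then ρ u else σ u

  stepF≡ : ∀ k u → stepF k u ≡ enc (step k (dec u))
  stepF≡ k u with k (gap (dec u))
  ... | true  = refl
  ... | false = refl

  stepF-cover : ∀ k → IsCycleCover (stepF k)
  stepF-cover k = record
    { pred    = λ u → enc (back k (dec u))
    ; s∘pred  = λ v → trans (stepF≡ k (enc (back k (dec v)))) (trans (cong (enc ∘ step k) (dec∘enc (back k (dec v))))
                  (trans (cong enc (step∘back k (dec v))) (enc∘dec v)))
    ; pred∘s  = λ u → trans (cong (enc ∘ back k ∘ dec) (stepF≡ k u)) (trans (cong (enc ∘ back k) (dec∘enc (step k (dec u))))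
                  (trans (cong enc (back∘step k (dec u))) (enc∘dec u)))
    ; no-loop = λ u e → step≢ k (dec u) (trans (sym (dec∘enc (step k (dec u)))) (cong dec (trans (sym (stepF≡ k u)) e)))
    }

  stepF-connected : ∀ g → IsConnected (stepF (λ h → does (g Fin.≟ h)))
  stepF-connected g P closed x y Px =
    subst (λ z → P z ≡ true) (enc∘dec y) (along (everywhere (dec x) (dec y)) (subst (λ z → P z ≡ true) (sym (enc∘dec x)) Px))
    where
    open Break g
    along : ∀ {u v} → Star Next u v → P (enc u) ≡ true → P (enc v) ≡ true
    along Star.ε Pu = Pu
    along {u} (refl ◅ es) Pu = along es (subst (λ z → P z ≡ true)
      (trans (stepF≡ here? (enc u)) (cong (enc ∘ step here?) (dec∘enc u))) (closed (enc u) Pu))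

  E : Fin ν → Fin ν → Bool
  E u v = does (v Fin.≟ σ u) ∨ does (v Fin.≟ ρ u)

  open Digraph E

  arc-σ : ∀ u → Arc u (σ u)
  arc-σ u rewrite dec-true (σ u Fin.≟ σ u) refl = refl

  arc-ρ : ∀ u → Arc u (ρ u)
  arc-ρ u rewrite dec-true (ρ u Fin.≟ ρ u) refl = BoolP.∨-zeroʳ (does (ρ u Fin.≟ σ u))

  arc-cases : ∀ u v → Arc u v → v ≡ σ u ⊎ v ≡ ρ u
  arc-cases u v e with v Fin.≟ σ u | v Fin.≟ ρ u
  ... | yes p | _     = inj₁ p
  ... | no _  | yes p = inj₂ p

  -- The arcs of one Hamiltonian cycle H_g suffice; gap `zero` exists because n is a successor.
  strong : ∀ u v → Star Arc u v
  strong u v = subst₂ (Star Arc) (enc∘dec u) (enc∘dec v) (gmap enc (λ {u} {v} → arc {u} {v}) (everywhere (dec u) (dec v)))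
    where
    open Break zero
    arc : ∀ {u v} → Next u v → Arc (enc u) (enc v)
    arc {u} refl = subst (Arc (enc u)) (trans (stepF≡ here? (enc u)) (cong (enc ∘ step here?) (dec∘enc u)))
      (go (here? (τ (enc u))))
      where
      go : ∀ b → Arc (enc u) (if b then ρ (enc u) else σ (enc u))
      go true  = arc-ρ (enc u)
      go false = arc-σ (enc u)

  position : V → ℕ
  position = [ toℕ , toℕ ]′

  pos : Fin ν → ℕ
  pos u = position (dec u)

  c : Fin ν → Fin ν → ℕ
  c u v = ℕ.∣ pos u - pos v ∣

  a₀ bₙ : Fin ν
  a₀ = enc (inj₁ zero)
  bₙ = enc (inj₂ (fromℕ n))

  straight-a : ∀ h → straight (inj₁ (inject₁ h)) ≡ inj₁ (suc h)
  straight-a = step-a (λ _ → false)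
  straight-aₙ : straight (inj₁ (fromℕ n)) ≡ inj₁ zero
  straight-aₙ = step-aₙ (λ _ → false)
  cross-a : ∀ h → cross (inj₁ (inject₁ h)) ≡ inj₂ (inject₁ h)
  cross-a = step-a (λ _ → true)
  cross-aₙ : cross (inj₁ (fromℕ n)) ≡ inj₁ zero
  cross-aₙ = step-aₙ (λ _ → true)

  into-a₀ : ∀ u → Arc u a₀ → pos u ≡ n
  into-a₀ u e with arc-cases u a₀ e
  ... | inj₁ p = V-cases (λ v → inj₁ zero ≡ straight v → position v ≡ n)
        (λ h q → contradiction (trans q (straight-a h)) λ ()) (λ _ → FinP.toℕ-fromℕ n) (λ ()) (λ _ ())
        (dec u) (trans (sym (dec∘enc _)) (trans (cong dec p) (dec∘enc _)))
  ... | inj₂ p = V-cases (λ v → inj₁ zero ≡ cross v → position v ≡ n)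
        (λ h q → contradiction (trans q (cross-a h)) λ ()) (λ _ → FinP.toℕ-fromℕ n) (λ ()) (λ _ ())
        (dec u) (trans (sym (dec∘enc _)) (trans (cong dec p) (dec∘enc _)))

  into-bₙ : ∀ u → Arc u bₙ → pos u ≡ 0
  into-bₙ u e with arc-cases u bₙ e
  ... | inj₁ p = V-cases (λ v → inj₂ (fromℕ n) ≡ straight v → position v ≡ 0)
        (λ h q → contradiction (trans q (straight-a h)) λ ()) (λ q → contradiction (trans q straight-aₙ) λ ())
        (λ _ → refl) (λ h q → contradiction (inj₂-injective q) FinP.fromℕ≢inject₁)
        (dec u) (trans (sym (dec∘enc _)) (trans (cong dec p) (dec∘enc _)))
  ... | inj₂ p = V-cases (λ v → inj₂ (fromℕ n) ≡ cross v → position v ≡ 0)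
        (λ h q → contradiction (inj₂-injective (trans q (cross-a h))) FinP.fromℕ≢inject₁)
        (λ q → contradiction (trans q cross-aₙ) λ ()) (λ _ → refl) (λ _ ())
        (dec u) (trans (sym (dec∘enc _)) (trans (cong dec p) (dec∘enc _)))

  at : ∀ k → k ℕ.≤ n → Σ (Fin ν) λ v → pos v ≡ k
  at k k≤n = enc (inj₁ (fromℕ< (s≤s k≤n))) , trans (cong position (dec∘enc (inj₁ (fromℕ< (s≤s k≤n))))) (FinP.toℕ-fromℕ< (s≤s k≤n))

  open LineBound E pos a₀ bₙ (cong position (dec∘enc (inj₁ zero))) (trans (cong position (dec∘enc (inj₂ (fromℕ n)))) (FinP.toℕ-fromℕ n))
    into-a₀ into-bₙ at public using (closed-walk-cost)

-- Objective value of the extrapolated solution and the integrality ratio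

edgeCost≤ : ∀ {ν} (d : Fin ν → Fin ν → ℚ) u v {x} → 0ℚ ≤ x → (u ≢ v → d u v ≤ x) →
            edgeCost ν d (combine u v) ≤ x
edgeCost≤ {ν} d u v 0≤x d≤x with tailV ν (combine u v) Fin.≟ headV ν (combine u v)
... | yes _ = 0≤x
... | no ne rewrite cong proj₁ (FinP.remQuot-combine u v) | cong proj₂ (FinP.remQuot-combine u v) = d≤x ne

module _ {ν n t : ℕ} (t+2≤n : 2 ℕ.+ t ℕ.≤ n) (σ ρ : Fin ν → Fin ν) (τ : Fin ν → Fin n) where

  open Extrapolation t+2≤n σ ρ τ

  -- Over all the H_g together each vertex switches exactly once, so their total value is n
  -- `value a σ` minus one difference `value a σ - value a ρ`. The multiples of n then cancel
  -- against the weight of C.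
  objective-mix : ∀ (a : Fin (ν ℕ.* ν) → ℚ) →
    sum (λ i → a i * mix ⁅ i ⁆) ≡ r * ((1ℚ + ι t) * value a σ + value a ρ)
  objective-mix a = begin
    sum (λ i → a i * mix ⁅ i ⁆)
      ≡⟨ sum-cong-≗ (λ i → trans (*-congˡ (a i) (sum-cong-≗ (λ w → cong (λ b → weight w * 𝟙 b) (incl-⁅⁆ (arcs w) i))))
           (trans (*-distribˡ-sum (a i) (λ w → weight w * 𝟙 (arcs w i)))
             (sum-cong-≗ (λ w → swap (a i) (weight w) (𝟙 (arcs w i)))))) ⟩
    sum (λ i → sum (λ w → weight w * (a i * 𝟙 (arcs w i))))
      ≡⟨ ∑-comm (λ i w → weight w * (a i * 𝟙 (arcs w i))) ⟩
    sum (λ w → sum (λ i → weight w * (a i * 𝟙 (arcs w i))))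
      ≡⟨ sum-cong-≗ (λ w → trans (sym (*-distribˡ-sum (weight w) (λ i → a i * 𝟙 (arcs w i))))
           (*-congˡ (weight w) (edge-sum a (world w)))) ⟩
    weight zero * value a σ + sum (λ g → r * value a (world (suc g)))
      ≡⟨ +-congˡ (weight zero * value a σ) (trans (sym (*-distribˡ-sum r (λ g → value a (world (suc g))))) (*-congˡ r rest)) ⟩
    weight zero * value a σ + r * (ι n * value a σ - (value a σ - value a ρ))
      ≡⟨ solve 5 (λ r t n s p → r :* (con 1ℚ :+ (con 1ℚ :+ t) :- n) :* s :+ r :* (n :* s :- (s :- p)) :=
                               r :* ((con 1ℚ :+ t) :* s :+ p)) refl r (ι t) (ι n) (value a σ) (value a ρ) ⟩
    r * ((1ℚ + ι t) * value a σ + value a ρ) ∎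
    where
    open ≡-Reasoning
    open +-*-Solver
    swap : ∀ x y z → x * (y * z) ≡ y * (x * z)
    swap = solve 3 (λ x y z → x :* (y :* z) := y :* (x :* z)) refl
    gains : sum (λ g → value a σ - value a (world (suc g))) ≡ value a σ - value a ρ
    gains = begin
      sum (λ g → value a σ - value a (world (suc g)))
        ≡⟨ sum-cong-≗ (λ g → sym (ℚP.*-identityˡ (value a σ - value a (world (suc g))))) ⟩
      sum (λ g → 1ℚ * (value a σ - value a (world (suc g))))
        ≡⟨ switch-gain a (λ _ → true) ⟩
      sum (λ u → 1ℚ * (a (combine u (σ u)) - a (combine u (ρ u))))
        ≡⟨ sum-cong-≗ (λ u → ℚP.*-identityˡ (a (combine u (σ u)) - a (combine u (ρ u)))) ⟩
      sum (λ u → a (combine u (σ u)) - a (combine u (ρ u)))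
        ≡⟨ sum-minus (λ u → a (combine u (σ u))) (λ u → a (combine u (ρ u))) ⟩
      value a σ - value a ρ ∎
    rest : sum (λ g → value a (world (suc g))) ≡ ι n * value a σ - (value a σ - value a ρ)
    rest = begin
      sum (λ g → value a (world (suc g)))
        ≡⟨ sum-cong-≗ (λ g → solve 2 (λ x y → y := con 1ℚ :* x :- (x :- y)) refl (value a σ) (value a (world (suc g)))) ⟩
      sum (λ g → 1ℚ * value a σ - (value a σ - value a (world (suc g))))
        ≡⟨ sum-minus (λ _ → 1ℚ * value a σ) (λ g → value a σ - value a (world (suc g))) ⟩
      sum {n} (λ _ → 1ℚ * value a σ) - sum (λ g → value a σ - value a (world (suc g)))
        ≡⟨ cong₂ _-_ (trans (sym (*-distribʳ-sum {n} (value a σ) (λ _ → 1ℚ))) (cong (_* value a σ) (sum-one n))) gains ⟩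
      ι n * value a σ - (value a σ - value a ρ) ∎

module LadderCost (n′ : ℕ) where

  open Ladder n′
  open Digraph E
  open Completion c strong public

  d : Fin ν → Fin ν → ℚ
  d u v = ι (dist u v)

  length-of : (V → V) → V → ℚ
  length-of f v = ι ℕ.∣ position v - position (f v) ∣

  -- An upper bound suffices for the fractional cost, and on arcs of G the metric cost is at most
  -- the arc length. The four summands follow the cases of `V-cases`.
  value≤ : ∀ f → (∀ u → Arc u (enc (f (dec u)))) →
    value (edgeCost ν d) (λ u → enc (f (dec u))) ≤
      sum (λ h → length-of f (inj₁ (inject₁ h))) + length-of f (inj₁ (fromℕ n)) +
      (length-of f (inj₂ zero) + sum (λ h → length-of f (inj₂ (suc h))))
  value≤ f arc = begin
    value (edgeCost ν d) (λ u → enc (f (dec u)))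
      ≤⟨ sum-mono (λ u → edgeCost≤ d u (enc (f (dec u))) (ι-nonneg (c u (enc (f (dec u))))) (λ ne → ι-mono (dist≤c ne (arc u)))) ⟩
    sum (λ u → ι (c u (enc (f (dec u)))))
      ≡⟨ sum-cong-≗ (λ u → cong (λ v → ι ℕ.∣ pos u - position v ∣) (dec∘enc (f (dec u)))) ⟩
    sum (λ u → length-of f (dec u))
      ≡⟨ sum-↑ (suc n) {suc n} (λ u → length-of f (dec u)) ⟩
    sum {suc n} (λ i → length-of f (dec (i ↑ˡ suc n))) + sum {suc n} (λ i → length-of f (dec (suc n ↑ʳ i)))
      ≡⟨ cong₂ _+_ (sum-cong-≗ {suc n} (λ i → cong (length-of f) (FinP.splitAt-↑ˡ (suc n) i (suc n))))
                   (sum-cong-≗ {suc n} (λ i → cong (length-of f) (FinP.splitAt-↑ʳ (suc n) (suc n) i))) ⟩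
    sum (λ i → length-of f (inj₁ i)) + sum (λ i → length-of f (inj₂ i))
      ≡⟨ cong (_+ sum (λ i → length-of f (inj₂ i))) (sum-init-last (λ i → length-of f (inj₁ i))) ⟩
    sum (λ h → length-of f (inj₁ (inject₁ h))) + length-of f (inj₁ (fromℕ n)) + sum (λ i → length-of f (inj₂ i)) ∎
    where
    open ℚP.≤-Reasoning

  ∣k-1+k∣≡1 : ∀ k → ℕ.∣ k - suc k ∣ ≡ 1
  ∣k-1+k∣≡1 zero    = refl
  ∣k-1+k∣≡1 (suc k) = ∣k-1+k∣≡1 k

  sum-ones : ∀ {f : Fin n → ℚ} → (∀ h → f h ≡ 1ℚ) → sum f ≡ ι n
  sum-ones h = trans (sum-cong-≗ h) (sum-one n)

  sum-zeros : ∀ {f : Fin n → ℚ} → (∀ h → f h ≡ 0ℚ) → sum f ≡ 0ℚ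
  sum-zeros h = trans (sum-cong-≗ h) (sum-replicate-zero n)

  value-σ≤ : value (edgeCost ν d) σ ≤ ι n + ι n + (ι n + ι n)
  value-σ≤ = ℚP.≤-trans (value≤ straight arc-σ) (ℚP.≤-reflexive (cong₂ _+_
    (cong₂ _+_ (sum-ones a) aₙ) (cong₂ _+_ b₀ (sum-ones b))))
    where
    a : ∀ h → length-of straight (inj₁ (inject₁ h)) ≡ 1ℚ
    a h = cong ι (trans (cong₂ ℕ.∣_-_∣ (FinP.toℕ-inject₁ h) (cong position (straight-a h))) (∣k-1+k∣≡1 (toℕ h)))
    aₙ : length-of straight (inj₁ (fromℕ n)) ≡ ι n
    aₙ = cong ι (cong₂ ℕ.∣_-_∣ (FinP.toℕ-fromℕ n) (cong position straight-aₙ))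
    b₀ : length-of straight (inj₂ zero) ≡ ι n
    b₀ = cong ι (FinP.toℕ-fromℕ n)
    b : ∀ h → length-of straight (inj₂ (suc h)) ≡ 1ℚ
    b h = cong ι (trans (cong (λ k → ℕ.∣ suc (toℕ h) - k ∣) (FinP.toℕ-inject₁ h))
                        (trans (ℕP.∣-∣-comm (suc (toℕ h)) (toℕ h)) (∣k-1+k∣≡1 (toℕ h))))

  -- The rungs are free, so only the two long arcs contribute.
  value-ρ≤ : value (edgeCost ν d) ρ ≤ ι n + ι n
  value-ρ≤ = ℚP.≤-trans (value≤ cross arc-ρ) (ℚP.≤-reflexive (cong₂ _+_
    (trans (cong₂ _+_ (sum-zeros a) aₙ) (ℚP.+-identityˡ (ι n)))
    (trans (cong₂ _+_ b₀ (sum-zeros b)) (ℚP.+-identityʳ (ι n)))))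
    where
    a : ∀ h → length-of cross (inj₁ (inject₁ h)) ≡ 0ℚ
    a h = cong ι (trans (cong (λ v → ℕ.∣ toℕ (inject₁ h) - position v ∣) (cross-a h)) (ℕP.∣n-n∣≡0 (toℕ (inject₁ h))))
    aₙ : length-of cross (inj₁ (fromℕ n)) ≡ ι n
    aₙ = cong ι (cong₂ ℕ.∣_-_∣ (FinP.toℕ-fromℕ n) (cong position cross-aₙ))
    b₀ : length-of cross (inj₂ zero) ≡ ι n
    b₀ = cong ι (FinP.toℕ-fromℕ n)
    b : ∀ h → length-of cross (inj₂ (suc h)) ≡ 0ℚ
    b h = cong ι (ℕP.∣n-n∣≡0 (suc (toℕ h)))

  tour-cost : ∀ C → (∀ v → v ∈ C) → Σ ℕ λ k → cycleCost d C ≡ ι k × 4 ℕ.* n ℕ.≤ 2 ℕ.+ k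
  tour-cost [] covers = contradiction (covers a₀) λ ()
  tour-cost (x ∷ xs) covers =
    let (W , eq , visits) = tour⇒walk x xs x
    in costℕ dist (x ∷ xs ++ x ∷ []) , pathCost-ι dist (x ∷ xs ++ x ∷ []) ,
       subst (λ k → 4 ℕ.* n ℕ.≤ 2 ℕ.+ k) eq
         (closed-walk-cost c (λ _ _ _ → ℕP.≤-refl) W (λ y → visits y (covers y)))

  tour-positive : ∀ k → 4 ℕ.* n ℕ.≤ 2 ℕ.+ k → 0 ℕ.< k
  tour-positive zero    4n≤2 with s≤s (s≤s ()) ← ℕP.≤-trans (ℕP.*-monoʳ-≤ 4 (s≤s (z≤n {n′}))) 4n≤2
  tour-positive (suc k) _ = s≤s z≤n

  module _ {t : ℕ} (t+2≤n : 2 ℕ.+ t ℕ.≤ n) where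

    open Extrapolation t+2≤n σ ρ τ using (mix; r; world)

    mix∈SA-ladder : InSA t ν mix
    mix∈SA-ladder = mix∈SA t+2≤n σ ρ τ cover stepF-connected
      where
      cover : ∀ w → IsCycleCover (world w)
      cover zero    = stepF-cover (λ _ → false)
      cover (suc g) = stepF-cover (λ h → does (g Fin.≟ h))

    lpCost≤ : lpCost d mix ≤ r * ((ι n + ι n) * ι (3 ℕ.+ 2 ℕ.* t))
    lpCost≤ = begin
      lpCost d mix
        ≡⟨ sum-allFin (λ i → edgeCost ν d i * mix ⁅ i ⁆) ⟩
      sum (λ i → edgeCost ν d i * mix ⁅ i ⁆)
        ≡⟨ objective-mix t+2≤n σ ρ τ (edgeCost ν d) ⟩
      r * ((1ℚ + ι t) * value (edgeCost ν d) σ + value (edgeCost ν d) ρ)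
        ≤⟨ *-monoˡ (1/suc-nonneg (suc t)) (ℚP.+-mono-≤ (*-monoˡ (ι-nonneg (suc t)) value-σ≤) value-ρ≤) ⟩
      r * ((1ℚ + ι t) * (ι n + ι n + (ι n + ι n)) + (ι n + ι n))
        ≡⟨ *-congˡ r (trans
             (solve 2 (λ t n → (con 1ℚ :+ t) :* (n :+ n :+ (n :+ n)) :+ (n :+ n) :=
                (n :+ n) :* (con 1ℚ :+ (con 1ℚ :+ (con 1ℚ :+ (t :+ t))))) refl (ι t) (ι n))
             (*-congˡ (ι n + ι n) (sym 3+2t))) ⟩
      r * ((ι n + ι n) * ι (3 ℕ.+ 2 ℕ.* t)) ∎
      where
      open ℚP.≤-Reasoning
      open +-*-Solver
      3+2t : ι (3 ℕ.+ 2 ℕ.* t) ≡ 1ℚ + (1ℚ + (1ℚ + (ι t + ι t)))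
      3+2t = cong (λ x → 1ℚ + (1ℚ + (1ℚ + x))) (trans (cong (λ k → ι (t ℕ.+ k)) (ℕP.+-identityʳ t)) (ι-+ t t))

    -- Multiplying 2n(2t+3)/M by 1 + (1-ε)/(2t+3) gives 2n(2M-ε)/M = 4n - 2εn/M. The hypothesis M ≤
    -- εn brings this down to 4n - 2, the lower bound for tours.
    ratio : ∀ {ε} → ε ≤ 1ℚ → ι (2 ℕ.+ t) ≤ ε * ι n → ∀ {k} → 4 ℕ.* n ℕ.≤ 2 ℕ.+ k →
      (1ℚ + (1ℚ - ε) * (+ 1 / (3 ℕ.+ 2 ℕ.* t))) * lpCost d mix ≤ ι k
    ratio {ε} ε≤1 large {k} tour = begin
      (1ℚ + (1ℚ - ε) * q) * lpCost d mix
        ≤⟨ *-monoˡ (ℚP.+-mono-≤ 0≤1 (*-nonneg (p≤q⇒0≤q-p ε≤1) (1/suc-nonneg (2 ℕ.+ 2 ℕ.* t)))) lpCost≤ ⟩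
      (1ℚ + (1ℚ - ε) * q) * (r * ((ι n + ι n) * ι (3 ℕ.+ 2 ℕ.* t)))
        ≡⟨ solve 5 (λ e q r n z → (con 1ℚ :+ (con 1ℚ :- e) :* q) :* (r :* ((n :+ n) :* z)) :=
             r :* (n :+ n) :* (z :+ (con 1ℚ :- e) :* (q :* z))) refl ε q r (ι n) (ι (3 ℕ.+ 2 ℕ.* t)) ⟩
      r * (ι n + ι n) * (ι (3 ℕ.+ 2 ℕ.* t) + (1ℚ - ε) * (q * ι (3 ℕ.+ 2 ℕ.* t)))
        ≡⟨ cong₂ (λ x y → r * (ι n + ι n) * (x + (1ℚ - ε) * y)) 3+2t (1/suc-inverse (2 ℕ.+ 2 ℕ.* t)) ⟩
      r * (ι n + ι n) * ((1ℚ + (ι t + ι (2 ℕ.+ t))) + (1ℚ - ε) * 1ℚ)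
        ≡⟨ solve 4 (λ e r n t →
             r :* (n :+ n) :* ((con 1ℚ :+ (t :+ (con 1ℚ :+ (con 1ℚ :+ t)))) :+ (con 1ℚ :- e) :* con 1ℚ) :=
             (n :+ n :+ (n :+ n)) :* (r :* (con 1ℚ :+ (con 1ℚ :+ t))) :- (r :* (e :* n) :+ r :* (e :* n)))
             refl ε r (ι n) (ι t) ⟩
      (ι n + ι n + (ι n + ι n)) * (r * ι (2 ℕ.+ t)) - (r * (ε * ι n) + r * (ε * ι n))
        ≤⟨ ℚP.+-mono-≤ (ℚP.≤-reflexive (trans (*-congˡ (ι n + ι n + (ι n + ι n)) (1/suc-inverse (suc t))) (ℚP.*-identityʳ (ι n + ι n + (ι n + ι n)))))
             (ℚP.neg-antimono-≤ (ℚP.+-mono-≤ 1≤rεn 1≤rεn)) ⟩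
      (ι n + ι n + (ι n + ι n)) - (1ℚ + 1ℚ)
        ≡⟨ cong (_- (1ℚ + 1ℚ)) 4n ⟨
      ι (4 ℕ.* n) - (1ℚ + 1ℚ)
        ≤⟨ ℚP.+-monoˡ-≤ (- (1ℚ + 1ℚ)) (ι-mono tour) ⟩
      ι (2 ℕ.+ k) - (1ℚ + 1ℚ)
        ≡⟨ solve 1 (λ k → con 1ℚ :+ (con 1ℚ :+ k) :- (con 1ℚ :+ con 1ℚ) := k) refl (ι k) ⟩
      ι k ∎
      where
      open ℚP.≤-Reasoning
      open +-*-Solver
      q = + 1 / (3 ℕ.+ 2 ℕ.* t)
      3+2t : ι (3 ℕ.+ 2 ℕ.* t) ≡ 1ℚ + (ι t + ι (2 ℕ.+ t))
      3+2t = trans (cong ι (regroup t)) (+-congˡ 1ℚ (ι-+ t (2 ℕ.+ t)))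
        where
        regroup : ∀ t → 3 ℕ.+ 2 ℕ.* t ≡ 1 ℕ.+ (t ℕ.+ (2 ℕ.+ t))
        regroup = ℕRing.solve-∀
      4n : ι (4 ℕ.* n) ≡ ι n + ι n + (ι n + ι n)
      4n = trans (cong ι (regroup n)) (trans (ι-+ (n ℕ.+ n) (n ℕ.+ n)) (cong₂ _+_ (ι-+ n n) (ι-+ n n)))
        where
        regroup : ∀ n → 4 ℕ.* n ≡ (n ℕ.+ n) ℕ.+ (n ℕ.+ n)
        regroup = ℕRing.solve-∀
      1≤rεn : 1ℚ ≤ r * (ε * ι n)
      1≤rεn = subst (_≤ r * (ε * ι n)) (1/suc-inverse (suc t)) (*-monoˡ (1/suc-nonneg (suc t)) large)

-- Choice of the parameters

-- The product is the numerator of `ε`, a positive integer.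
1≤ε*denominator : ∀ ε → 0ℚ < ε → 1ℚ ≤ ε * ι (ℚ.denominatorℕ ε)
1≤ε*denominator ε@(ℚ.mkℚ (+ suc p) b-1 _) _ = subst₂ _≤_ (1/suc-inverse b-1) refl
  (ℚP.*-monoʳ-≤-nonNeg (ι (suc b-1)) ⦃ ℚ.nonNegative (ι-nonneg (suc b-1)) ⦄ (ℚP.toℚᵘ-cancel-≤
    (ℚᵘP.≤-respˡ-≃ (ℚᵘP.≃-sym (ℚP.toℚᵘ-fromℚᵘ (ℚᵘ.mkℚᵘ (+ 1) b-1)))
      (ℚᵘ.*≤* (ℤP.*-monoʳ-≤-nonNeg (+ suc b-1) (ℤ.+≤+ {n = suc p} (s≤s z≤n)))))))
1≤ε*denominator (ℚ.mkℚ (+ 0) _ _)         (ℚ.*<* (ℤ.+<+ ()))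
1≤ε*denominator (ℚ.mkℚ (ℤ.-[1+ _ ]) _ _) (ℚ.*<* ())

-- Descend from `k` while the product stays at least 1. At the stop ε m < 1, so ε (m + 1) ≤ 1 + ε ≤
-- 2. The upper bound keeps ν of order t/ε.
integer-between : ∀ {ε} → ε ≤ 1ℚ → ∀ k → 1ℚ ≤ ε * ι k → Σ ℕ λ m → 1ℚ ≤ ε * ι (suc m) × ε * ι (suc m) ≤ 1ℚ + 1ℚ
integer-between {ε} ε≤1 zero 1≤0 = contradiction
  (ℚP.<-≤-trans (ℚP.positive⁻¹ 1ℚ) (subst (1ℚ ≤_) (ℚP.*-zeroʳ ε) 1≤0)) (ℚP.<-irrefl refl)
integer-between {ε} ε≤1 (suc k) h with 1ℚ ℚP.≤? ε * ι k
... | yes 1≤εk = integer-between ε≤1 k 1≤εk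
... | no 1≰εk  = k , h , subst (_≤ 1ℚ + 1ℚ) (sym (trans (ℚP.*-distribˡ-+ ε 1ℚ (ι k)) (cong (_+ ε * ι k) (ℚP.*-identityʳ ε))))
  (ℚP.+-mono-≤ ε≤1 (ℚP.<⇒≤ (ℚP.≰⇒> 1≰εk)))

module Instance (t N : ℕ) {ε : ℚ} (0<ε : 0ℚ < ε) (ε≤1 : ε ≤ 1ℚ)
  (1≤εN : 1ℚ ≤ ε * ι (suc N)) (εN≤2 : ε * ι (suc N) ≤ 1ℚ + 1ℚ) where

  n′ : ℕ
  -- Chosen so that `suc n′` is definitionally (t + 2) (N + 1).
  n′ = N ℕ.+ suc t ℕ.* suc N

  open Ladder n′ public
  open LadderCost n′ public

  t+2≤n : 2 ℕ.+ t ℕ.≤ n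
  t+2≤n = ℕP.m≤m*n (2 ℕ.+ t) (suc N)
  open Extrapolation t+2≤n σ ρ τ using (mix) public

  εn : ε * ι n ≡ ι (2 ℕ.+ t) * (ε * ι (suc N))
  εn = trans (*-congˡ ε (ι-* (2 ℕ.+ t) (suc N)))
    (solve 3 (λ e x y → e :* (x :* y) := x :* (e :* y)) refl ε (ι (2 ℕ.+ t)) (ι (suc N)))
    where
    open +-*-Solver
  t+2≤εn : ι (2 ℕ.+ t) ≤ ε * ι n
  t+2≤εn = subst₂ _≤_ (ℚP.*-identityʳ (ι (2 ℕ.+ t))) (sym εn) (*-monoˡ (ι-nonneg (2 ℕ.+ t)) 1≤εN)
  εn≤2t+4 : ε * ι n ≤ ι (2 ℕ.+ t) * (1ℚ + 1ℚ)
  εn≤2t+4 = subst (_≤ ι (2 ℕ.+ t) * (1ℚ + 1ℚ)) (sym εn) (*-monoˡ (ι-nonneg (2 ℕ.+ t)) εN≤2)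

  lower-bound : 1ℚ * (+ suc t / 1) ≤ ε * (+ ν / 1)
  lower-bound = begin
    1ℚ * (+ suc t / 1)  ≡⟨ ℚP.*-identityˡ (+ suc t / 1) ⟩
    + suc t / 1         ≡⟨ ι≡/1 (suc t) ⟨
    ι (suc t)           ≤⟨ ι-mono (ℕP.n≤1+n (suc t)) ⟩
    ι (2 ℕ.+ t)         ≤⟨ t+2≤εn ⟩
    ε * ι n             ≤⟨ *-monoˡ (ℚP.<⇒≤ 0<ε) (ι-mono (ℕP.≤-trans (ℕP.n≤1+n n) (ℕP.m≤m+n (suc n) (suc n)))) ⟩
    ε * ι ν             ≡⟨ *-congˡ ε (ι≡/1 ν) ⟩
    ε * (+ ν / 1)       ∎
    where
    open ℚP.≤-Reasoning

  -- With ν = 2(n + 1), ε ≤ 1 and εn ≤ 2(t + 2), the left side is at most 2 + 4(t + 2) = 4t + 10,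
  -- hence at most 10(t + 1).
  upper-bound : ε * (+ ν / 1) ≤ ι 10 * (+ suc t / 1)
  upper-bound = begin
    ε * (+ ν / 1)
      ≡⟨ *-congˡ ε (ι≡/1 ν) ⟨
    ε * ι ν
      ≡⟨ *-congˡ ε (ι-+ (suc n) (suc n)) ⟩
    ε * (ι (suc n) + ι (suc n))
      ≡⟨ solve 2 (λ e x → e :* ((con 1ℚ :+ x) :+ (con 1ℚ :+ x)) := (e :+ e) :+ (e :* x :+ e :* x)) refl ε (ι n) ⟩
    (ε + ε) + (ε * ι n + ε * ι n)
      ≤⟨ ℚP.+-mono-≤ (ℚP.+-mono-≤ ε≤1 ε≤1) (ℚP.+-mono-≤ εn≤2t+4 εn≤2t+4) ⟩
    (1ℚ + 1ℚ) + (ι (2 ℕ.+ t) * (1ℚ + 1ℚ) + ι (2 ℕ.+ t) * (1ℚ + 1ℚ))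
      ≡⟨ +-congˡ (1ℚ + 1ℚ) (trans (sym (ℚP.*-distribˡ-+ (ι (2 ℕ.+ t)) (1ℚ + 1ℚ) (1ℚ + 1ℚ))) (sym (ι-* (2 ℕ.+ t) 4))) ⟩
    ι 2 + ι ((2 ℕ.+ t) ℕ.* 4)
      ≡⟨ ι-+ 2 ((2 ℕ.+ t) ℕ.* 4) ⟨
    ι (2 ℕ.+ (2 ℕ.+ t) ℕ.* 4)
      ≤⟨ ι-mono (subst (2 ℕ.+ (2 ℕ.+ t) ℕ.* 4 ℕ.≤_) (regroup t) (ℕP.m≤m+n _ (6 ℕ.* t))) ⟩
    ι (10 ℕ.* suc t)
      ≡⟨ ι-* 10 (suc t) ⟩
    ι 10 * ι (suc t)
      ≡⟨ *-congˡ (ι 10) (ι≡/1 (suc t)) ⟩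
    ι 10 * (+ suc t / 1) ∎
    where
    open ℚP.≤-Reasoning
    open +-*-Solver
    regroup : ∀ t → 2 ℕ.+ (2 ℕ.+ t) ℕ.* 4 ℕ.+ 6 ℕ.* t ≡ 10 ℕ.* suc t
    regroup = ℕRing.solve-∀

  positive-cost : (C : List (Fin ν)) → IsHamiltonianDicycle C → 0ℚ < cycleCost d C
  positive-cost C (_ , covers) =
    let (k , eq , tour) = tour-cost C covers in subst (0ℚ <_) (sym eq) (0<ι (tour-positive k tour))

  ratio-bound : (C : List (Fin ν)) → IsHamiltonianDicycle C →
    (1ℚ + (1ℚ - ε) * (+ 1 / (3 ℕ.+ 2 ℕ.* t))) * lpCost d mix ≤ cycleCost d C
  ratio-bound C (_ , covers) =
    let (k , eq , tour) = tour-cost C covers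
    in subst ((1ℚ + (1ℚ - ε) * (+ 1 / (3 ℕ.+ 2 ℕ.* t))) * lpCost d mix ≤_) (sym eq) (ratio t+2≤n ε≤1 t+2≤εn tour)

-- The order of ν is measured by t + 1 so that t = 0 is covered. One feasible `y` suffices, since
-- the minimum over the tightening is at most its cost; positive tour costs exclude a ratio of
-- zeros.
theorem6 : Σ ℚ λ ε₀ → Σ ℚ λ c₁ → Σ ℚ λ c₂ → (0ℚ < ε₀) × (0ℚ < c₁) × (0ℚ < c₂) ×
    ((t : ℕ) (ε : ℚ) → 0ℚ < ε → ε < ε₀ →
    Σ ℕ λ ν →
    (c₁ * (+ ℕ.suc t / 1) ≤ ε * (+ ν / 1)) × (ε * (+ ν / 1) ≤ c₂ * (+ ℕ.suc t / 1)) ×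
    Σ (Fin ν → Fin ν → Bool) λ E → Σ (Fin ν → Fin ν → ℚ) λ c →
    ((v w : Fin ν) → E v w ≡ true → 0ℚ ≤ c v w) ×
    Σ (Fin ν → Fin ν → ℚ) λ d → IsMetricCompletion E c d ×
    ((C : List (Fin ν)) → IsHamiltonianDicycle C → 0ℚ < cycleCost d C) ×
    Σ (Subset (ν ℕ.* ν) → ℚ) λ y → InSA t ν y ×
    ((C : List (Fin ν)) → IsHamiltonianDicycle C →
    (1ℚ + (1ℚ - ε) * (+ 1 / (3 ℕ.+ 2 ℕ.* t))) * lpCost d y ≤ cycleCost d C))
-- The threshold 1 is enough: the construction asks only for 0 < ε ≤ 1.
theorem6 = 1ℚ , 1ℚ , ι 10 , ℚP.positive⁻¹ 1ℚ , ℚP.positive⁻¹ 1ℚ , 0<ι {10} (s≤s z≤n) , λ t ε 0<ε ε<1 →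
  let (N , 1≤εN , εN≤2) = integer-between (ℚP.<⇒≤ ε<1) (ℚ.denominatorℕ ε) (1≤ε*denominator ε 0<ε)
      module I = Instance t N 0<ε (ℚP.<⇒≤ ε<1) 1≤εN εN≤2
  in I.ν , I.lower-bound , I.upper-bound , I.E , (λ u v → ι (I.c u v)) , (λ u v _ → ι-nonneg (I.c u v)) ,
     I.d , I.dist-isMetricCompletion , I.positive-cost , I.mix , I.mix∈SA-ladder I.t+2≤n , I.ratio-bound
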